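{- For a positive integer $m$, let $\mathcal{L}_m$ denote the number of vertices of a longest (simple) path in a Random Apollonian Network with $m$ bounded faces. Then asymptotically almost surely $\mathcal{L}_m = o(m)$; that is, for every fixed $\varepsilon>0$, $\lim_{m\to\infty}\mathbb{P}(\mathcal{L}_m \le \varepsilon m) = 1$.
   Context: A Random Apollonian Network (RAN) is built as follows: start with a triangle embedded in the plane; in each step choose a bounded face uniformly at random (independently of previous choices), add a new vertex inside it and join the new vertex to the three vertices of that face. After $n-3$ steps one obtains a random triangulated plane graph with $n$ vertices and $m=2n-5$ bounded faces; "faces" always means bounded faces. A path means a simple path. -}

module Defs where

open import Data.Nat using (ℕ; zero; suc; _+_; _<_)
open import Data.Fin using (Fin)
open import Data.Vec using (Vec; _∷_; []; lookup; removeAt)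
open import Data.List using (List; _∷_; []; length)
open import Data.Product using (_×_; _,_; proj₁; proj₂)
open import Data.Sum using (_⊎_)
open import Data.Integer using (+_)
open import Data.Rational using (ℚ; _/_; _≤_; _*_)
open import Data.List.Membership.Propositional using (_∈_)
open import Data.List.Relation.Unary.All using (All)
open import Data.List.Relation.Unary.Linked using (Linked)
open import Data.List.Relation.Unary.Unique.Propositional using (Unique)

-- fc k = 2k, so that a RAN after k insertion steps has suc (fc k) = 2k+1
-- bounded faces and 3 + k vertices.
fc : ℕ → ℕ
fc zero = 0
fc (suc k) = suc (suc (fc k))

faces : ℕ → ℕ
faces k = suc (fc k)

-- A history of k steps: at step i one of the faces (i) bounded faces is chosen.
-- Each history has probability 1 / ∏_{i<k} faces i (independent uniform choices).
data Hist : ℕ → Set where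
  []  : Hist 0
  _▷_ : ∀ {k} → Hist k → Fin (faces k) → Hist (suc k)

Face : Set
Face = ℕ × ℕ × ℕ

Edge : Set
Edge = ℕ × ℕ

-- Vertices are 0,1,2 (the initial triangle) and 3 + i (inserted at step i).
-- build h = (list of bounded faces, list of edges) of the resulting RAN.
build : ∀ {k} → Hist k → Vec Face (faces k) × List Edge
build [] = ((0 , 1 , 2) ∷ []) , ((0 , 1) ∷ (1 , 2) ∷ (0 , 2) ∷ [])
build {suc k} (h ▷ j) = step (lookup fs j)
  where
  fs : Vec Face (faces k)
  fs = proj₁ (build h)
  es : List Edge
  es = proj₂ (build h)
  v : ℕ
  v = 3 + k
  step : Face → Vec Face (faces (suc k)) × List Edge
  step (a , b , c) =
    ((a , b , v) ∷ (a , c , v) ∷ (b , c , v) ∷ removeAt fs j)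
    , ((a , v) ∷ (b , v) ∷ (c , v) ∷ es)

Adj : ∀ {k} → Hist k → ℕ → ℕ → Set
Adj h u v = ((u , v) ∈ proj₂ (build h)) ⊎ ((v , u) ∈ proj₂ (build h))

SimplePath : ∀ {k} → Hist k → List ℕ → Set
SimplePath {k} h p = All (_< 3 + k) p × Linked (Adj h) p × Unique p

total : ℕ → ℕ
total zero = 1
total (suc k) = total k Data.Nat.* faces k

ℕ→ℚ : ℕ → ℚ
ℕ→ℚ n = + n / 1

LongestPathAtMost : ℚ → ∀ {k} → Hist k → Set
LongestPathAtMost ε {k} h =
  ∀ (p : List ℕ) → SimplePath h p → ℕ→ℚ (length p) ≤ ε * ℕ→ℚ (faces k)

ProbAtLeast : ∀ k → (Hist k → Set) → ℚ → Set
ProbAtLeast k E r =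
  Data.Product.Σ (List (Hist k)) λ hs →
    Unique hs × All E hs × (r * ℕ→ℚ (total k) ≤ ℕ→ℚ (length hs))

{-# OPTIONS --safe #-}
module Submission where

-- A RAN is the ternary tree of its insertions.  In a triangle all of whose
-- three children are subdivided, three corners and four inner vertices separate
-- the nine grandchildren, and a path cannot use seven vertices to visit nine
-- separated regions: it misses one of them.  If that triangle is balanced, i.e.
-- each grandchild holds at least a fraction 1 / M of its faces, then a fraction
-- 1 / M is lost.  By the Cauchy–Schwarz inequality, down to depth 2 d the square
-- of the number of faces a path can reach is at most the number of faces times
-- an additive potential Ψ d, which every balanced triangle multiplies by
-- 1 - 1 / M.  Given the sizes of the subtrees these are independent uniform
-- trees, and a triangle is balanced with probability at least 1 / M, because
-- the product of the nine sizes has an explicit expectation of order (size) ^ 9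
-- (a Pólya urn).  Hence E (Ψ d) ≤ (1 - 1 / M²) ^ d · size + O(1), and Markov's
-- inequality concludes.

open import Defs
open import Data.Nat using (ℕ; zero; suc; _+_; _*_; _∸_; _^_; _≤_; _<_; _≥_; z≤n; s≤s; NonZero; _≟_; _≤?_; >-nonZero⁻¹)
open import Data.Nat.Properties
open import Data.Nat.Tactic.RingSolver using (solve-∀)
open import Data.Fin using (Fin; zero; suc)
import Data.Integer as ℤ
import Data.Integer.Properties as ℤ
open import Data.Rational using (ℚ; Positive; _-_; 1ℚ; mkℚ; toℚᵘ; ↧ₙ_)
import Data.Rational as ℚ
import Data.Rational.Properties as ℚ
import Data.Rational.Unnormalised as ℚᵘ
import Data.Rational.Unnormalised.Properties as ℚᵘ
open import Data.Vec using (Vec; []; _∷_; lookup; removeAt; toList)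
import Data.Vec as Vec
import Data.Vec.Properties as Vec
open import Data.List using (List; []; _∷_; _++_; _∷ʳ_; map; concatMap; length; allFin; tabulate; filter)
open import Data.List.Properties using (map-tabulate; filter-accept; filter-reject)
open import Data.List.Relation.Unary.All as All using (All; []; _∷_)
import Data.List.Relation.Unary.All.Properties as All
open import Data.List.Relation.Unary.AllPairs as AllPairs using ([]; _∷_)
import Data.List.Relation.Unary.AllPairs.Properties as AllPairs
open import Data.List.Relation.Unary.Any using (here; there)
open import Data.List.Relation.Unary.Linked using (Linked; []; [-]; _∷_)
open import Data.List.Relation.Unary.Unique.Propositional using (Unique)
import Data.List.Relation.Unary.Unique.Propositional.Properties as Unique
open import Data.List.Membership.Propositional using (_∈_)
open import Data.List.Membership.Propositional.Properties using (∈-++⁺ˡ; ∈-++⁺ʳ; ∈-++⁻; ∈-map⁻)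
open import Data.List.Relation.Binary.Permutation.Propositional using (_↭_; ↭-sym; ↭-refl; ↭-trans; prep)
import Data.List.Relation.Binary.Permutation.Propositional as Perm
open import Data.List.Relation.Binary.Permutation.Propositional.Properties
  using (drop-∷; shifts; ++⁺ˡ; ++⁺ʳ; map⁺; ∈-resp-↭)
open import Data.Product using (Σ; ∃; _×_; _,_; proj₁; proj₂)
open import Data.Sum using (_⊎_; inj₁; inj₂; [_,_]′)
import Data.Sum as Sum
open import Data.Unit using (⊤; tt)
open import Data.Empty using (⊥; ⊥-elim)
open import Function using (_∘_; id; it)
open import Relation.Nullary using (¬_; Dec; yes; no)
open import Relation.Binary.PropositionalEquality

-- The obstacle is that the path chooses which grandchild it misses: it may skip just those regions
-- in which further balanced triangles would cost it most, so the losses at successive levels cannot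
-- simply be multiplied and averaged. Cauchy-Schwarz decouples path and tree. In the bound of
-- `reach` squared by a product of two factors, the first carries the path and, thanks to the
-- losses, collapses level by level to the root; the second, `Ψ`, is determined by the tree alone
-- and is linear in the potentials of the grandchildren, so its expectation obeys a recursion. A
-- bound on `Ψ` then controls all paths at once.
--
-- Two levels are needed for a loss: at one level the four separating vertices allow a path to visit
-- up to five regions, and there are only three; at two levels they allow 1 + 7 = 8 of nine.
--
-- Probabilities stay integer counts: factors such as 1 - 1 / M become weights M - 1 set against
-- powers of M on the other side.

private variable
  L X Y : Set

-- Finite sums of natural numbers

∑ : List X → (X → ℕ) → ℕ
∑ [] f = 0
∑ (x ∷ xs) f = f x + ∑ xs f

infix 5 ∑
syntax ∑ xs (λ x → e) = ∑[ x ← xs ] e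

∑-congAll : {f g : X → ℕ} {xs : List X} → All (λ x → f x ≡ g x) xs → ∑ xs f ≡ ∑ xs g
∑-congAll [] = refl
∑-congAll (e ∷ es) = cong₂ _+_ e (∑-congAll es)

∑-cong : (xs : List X) {f g : X → ℕ} → (∀ x → f x ≡ g x) → ∑ xs f ≡ ∑ xs g
∑-cong xs e = ∑-congAll (All.universal e xs)

∑-monoAll : {f g : X → ℕ} {xs : List X} → All (λ x → f x ≤ g x) xs → ∑ xs f ≤ ∑ xs g
∑-monoAll [] = z≤n
∑-monoAll (e ∷ es) = +-mono-≤ e (∑-monoAll es)

∑-mono : (xs : List X) {f g : X → ℕ} → (∀ x → f x ≤ g x) → ∑ xs f ≤ ∑ xs g
∑-mono xs e = ∑-monoAll (All.universal e xs)

∑-zero : (xs : List X) → ∑ xs (λ _ → 0) ≡ 0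
∑-zero [] = refl
∑-zero (x ∷ xs) = ∑-zero xs

∑-+ : (xs : List X) (f g : X → ℕ) → ∑ xs (λ x → f x + g x) ≡ ∑ xs f + ∑ xs g
∑-+ [] f g = refl
∑-+ (x ∷ xs) f g rewrite ∑-+ xs f g = interchange (f x) (g x) (∑ xs f) (∑ xs g)
  where
  interchange : ∀ a b c d → a + b + (c + d) ≡ a + c + (b + d)
  interchange = solve-∀

∑-* : (xs : List X) (c : ℕ) (f : X → ℕ) → ∑ xs (λ x → c * f x) ≡ c * ∑ xs f
∑-* [] c f = sym (*-zeroʳ c)
∑-* (x ∷ xs) c f rewrite ∑-* xs c f = sym (*-distribˡ-+ c (f x) (∑ xs f))

∑-++ : (xs ys : List X) (f : X → ℕ) → ∑ (xs ++ ys) f ≡ ∑ xs f + ∑ ys f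
∑-++ [] ys f = refl
∑-++ (x ∷ xs) ys f rewrite ∑-++ xs ys f = sym (+-assoc (f x) _ _)

∑-map : (g : X → Y) (xs : List X) (f : Y → ℕ) → ∑ (map g xs) f ≡ ∑ xs (f ∘ g)
∑-map g [] f = refl
∑-map g (x ∷ xs) f = cong (f (g x) +_) (∑-map g xs f)

∑-concatMap : (g : X → List Y) (xs : List X) (f : Y → ℕ) →
  ∑ (concatMap g xs) f ≡ ∑[ x ← xs ] ∑ (g x) f
∑-concatMap g [] f = refl
∑-concatMap g (x ∷ xs) f =
  trans (∑-++ (g x) (concatMap g xs) f) (cong (∑ (g x) f +_) (∑-concatMap g xs f))

∑-swap : (xs : List X) (ys : List Y) (f : X → Y → ℕ) →
  (∑[ x ← xs ] ∑ ys (f x)) ≡ (∑[ y ← ys ] ∑[ x ← xs ] f x y)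
∑-swap [] ys f = sym (∑-zero ys)
∑-swap (x ∷ xs) ys f =
  trans (cong (∑ ys (f x) +_) (∑-swap xs ys f)) (sym (∑-+ ys (f x) _))

∑-↭ : {xs ys : List X} (f : X → ℕ) → xs ↭ ys → ∑ xs f ≡ ∑ ys f
∑-↭ f Perm.refl = refl
∑-↭ f (Perm.prep x p) = cong (f x +_) (∑-↭ f p)
∑-↭ f (Perm.swap {xs} {ys} x y p) = begin
  f x + (f y + ∑ xs f)  ≡⟨ +-assoc (f x) (f y) _ ⟨
  f x + f y + ∑ xs f    ≡⟨ cong₂ _+_ (+-comm (f x) (f y)) (∑-↭ f p) ⟩
  f y + f x + ∑ ys f    ≡⟨ +-assoc (f y) (f x) _ ⟩
  f y + (f x + ∑ ys f)  ∎
  where open ≡-Reasoning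
∑-↭ f (Perm.trans p q) = trans (∑-↭ f p) (∑-↭ f q)

-- Weighted counts of walks

walks : (X → List X) → ℕ → (X → ℕ) → X → ℕ
walks s zero f x = f x
walks s (suc n) f x = ∑ (s x) (walks s n f)

module _ (s : X → List X) where

  walks-mono : ∀ n {f g : X → ℕ} → (∀ x → f x ≤ g x) → ∀ x → walks s n f x ≤ walks s n g x
  walks-mono zero p x = p x
  walks-mono (suc n) p x = ∑-mono (s x) (walks-mono n p)

  walks-cong : ∀ n {f g : X → ℕ} → (∀ x → f x ≡ g x) → ∀ x → walks s n f x ≡ walks s n g x
  walks-cong zero p x = p x
  walks-cong (suc n) p x = ∑-cong (s x) (walks-cong n p)

  walks-+ : ∀ n (f g : X → ℕ) x → walks s n (λ y → f y + g y) x ≡ walks s n f x + walks s n g x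
  walks-+ zero f g x = refl
  walks-+ (suc n) f g x = trans (∑-cong (s x) (walks-+ n f g)) (∑-+ (s x) _ _)

  walks-* : ∀ n c (f : X → ℕ) x → walks s n (λ y → c * f y) x ≡ c * walks s n f x
  walks-* zero c f x = refl
  walks-* (suc n) c f x = trans (∑-cong (s x) (walks-* n c f)) (∑-* (s x) c _)

  -- `walks` peels off the first move; histories and interleaved walks are extended at the end.
  walks-suc : ∀ n (f : X → ℕ) x → walks s (suc n) f x ≡ walks s n (λ y → ∑ (s y) f) x
  walks-suc zero f x = refl
  walks-suc (suc n) f x = ∑-cong (s x) (walks-suc n f)

  walks-∑ : ∀ n (ys : List Y) (f : X → Y → ℕ) x →
    walks s n (λ x → ∑ ys (f x)) x ≡ (∑[ y ← ys ] walks s n (λ x → f x y) x)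
  walks-∑ zero ys f x = refl
  walks-∑ (suc n) ys f x =
    trans (∑-cong (s x) (walks-∑ n ys f)) (∑-swap (s x) ys _)

-- Lumpability of Markov chains: `φ` projects the moves `s` onto the moves `t`. Testing against sums
-- makes the order of the successors immaterial.
Lumps : (X → List X) → (Y → List Y) → (X → Y) → Set
Lumps s t φ = ∀ x f → ∑ (t (φ x)) f ≡ ∑ (s x) (f ∘ φ)

walks-lump : {s : X → List X} {t : Y → List Y} {φ : X → Y} → Lumps s t φ →
  ∀ n f x → walks t n f (φ x) ≡ walks s n (f ∘ φ) x
walks-lump l zero f x = refl
walks-lump {s = s} l (suc n) f x = trans (l x _) (∑-cong (s x) (walks-lump l n f))

-- Asynchronous product, one coordinate per move: this is how the subtrees of a node share the
-- insertions.
_⊗_ : (X → List X) → (Y → List Y) → X × Y → List (X × Y)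
(s ⊗ t) (x , y) = map (_, y) (s x) ++ map (x ,_) (t y)

∑-⊗ : (s : X → List X) (t : Y → List Y) (x : X) (y : Y) (f : X × Y → ℕ) →
  ∑ ((s ⊗ t) (x , y)) f ≡ (∑[ x′ ← s x ] f (x′ , y)) + (∑[ y′ ← t y ] f (x , y′))
∑-⊗ s t x y f =
  trans (∑-++ (map (_, y) (s x)) _ f) (cong₂ _+_ (∑-map (_, y) (s x) f) (∑-map (x ,_) (t y) f))

-- A walk in the product interleaves a walk in each factor.  Conditioning on
-- the moves of the second factor, the first factor has made j free moves.
walks-⊗-mono : (s : X → List X) (t : Y → List Y) (x : X) {f g : X × Y → ℕ} →
  (∀ j y → walks s j (λ x → f (x , y)) x ≤ walks s j (λ x → g (x , y)) x) →
  ∀ n y → walks (s ⊗ t) n f (x , y) ≤ walks (s ⊗ t) n g (x , y)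
walks-⊗-mono {X} {Y} s t x₀ {f} {g} dom n y = go n 0 y
  where
  -- A move of the product either lengthens the free walk of the first factor at its end or moves
  -- the second factor, and then the sum over `t y` can be pulled out.
  split : ∀ n j y (h : X × Y → ℕ) →
    walks s j (λ x → walks (s ⊗ t) (suc n) h (x , y)) x₀ ≡
    walks s (suc j) (λ x → walks (s ⊗ t) n h (x , y)) x₀ +
      (∑[ y′ ← t y ] walks s j (λ x → walks (s ⊗ t) n h (x , y′)) x₀)
  split n j y h = begin
    walks s j (λ x → walks (s ⊗ t) (suc n) h (x , y)) x₀
      ≡⟨ walks-cong s j (λ x → ∑-⊗ s t x y (walks (s ⊗ t) n h)) x₀ ⟩
    walks s j (λ x → ∑ (s x) (λ x′ → walks (s ⊗ t) n h (x′ , y)) +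
                     ∑ (t y) (λ y′ → walks (s ⊗ t) n h (x , y′))) x₀
      ≡⟨ walks-+ s j _ _ x₀ ⟩
    walks s j (λ x → ∑ (s x) (λ x′ → walks (s ⊗ t) n h (x′ , y))) x₀ +
    walks s j (λ x → ∑ (t y) (λ y′ → walks (s ⊗ t) n h (x , y′))) x₀
      ≡⟨ cong₂ _+_ (sym (walks-suc s j _ x₀)) (walks-∑ s j (t y) _ x₀) ⟩
    _ ∎
    where open ≡-Reasoning

  go : ∀ n j y → walks s j (λ x → walks (s ⊗ t) n f (x , y)) x₀ ≤
                 walks s j (λ x → walks (s ⊗ t) n g (x , y)) x₀
  go zero j y = dom j y
  go (suc n) j y = begin
    walks s j (λ x → walks (s ⊗ t) (suc n) f (x , y)) x₀  ≡⟨ split n j y f ⟩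
    _ ≤⟨ +-mono-≤ (go n (suc j) y) (∑-mono (t y) (go n j)) ⟩
    _ ≡⟨ split n j y g ⟨
    walks s j (λ x → walks (s ⊗ t) (suc n) g (x , y)) x₀  ∎
    where open ≤-Reasoning

-- Ternary trees under uniform growth

data Tree (L : Set) : Set where
  leaf : Tree L
  node : L → (a b c : Tree L) → Tree L

-- The number of leaves, i.e. of bounded faces.
size : Tree L → ℕ
size leaf = 1
size (node _ a b c) = size a + size b + size c

-- A leaf stands in for its own children, so that the trees summed over by `over^ i` always
-- partition the faces.
over : (Tree L → ℕ) → Tree L → ℕ
over f leaf = f leaf
over f (node _ a b c) = f a + f b + f c

over^ : ℕ → (Tree L → ℕ) → Tree L → ℕ
over^ zero f = f
over^ (suc i) f = over (over^ i f)

Shape : Set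
Shape = Tree ⊤

node′ : (a b c : Shape) → Shape
node′ = node tt

grow : Shape → List Shape
grow leaf = node′ leaf leaf leaf ∷ []
grow (node _ a b c) =
  map (λ a′ → node′ a′ b c) (grow a) ++
  map (λ b′ → node′ a b′ c) (grow b) ++
  map (λ c′ → node′ a b c′) (grow c)

∑-grow-node : ∀ a b c (f : Shape → ℕ) → ∑ (grow (node′ a b c)) f ≡
  (∑[ a′ ← grow a ] f (node′ a′ b c)) +
  ((∑[ b′ ← grow b ] f (node′ a b′ c)) + (∑[ c′ ← grow c ] f (node′ a b c′)))
∑-grow-node a b c f =
  trans (∑-++ (map _ (grow a)) _ f)
    (cong₂ _+_ (∑-map _ (grow a) f)
      (trans (∑-++ (map _ (grow b)) _ f) (cong₂ _+_ (∑-map _ (grow b) f) (∑-map _ (grow c) f))))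

grow-size : ∀ t → All (λ t′ → size t′ ≡ 2 + size t) (grow t)
grow-size leaf = refl ∷ []
grow-size (node _ a b c) =
  All.++⁺ (All.map⁺ (All.map (λ {a′} e → cong (λ z → z + size b + size c) e) (grow-size a)))
  (All.++⁺
    (All.map⁺ (All.map (λ {b′} e → trans (cong (λ z → size a + z + size c) e) (move₂ (size a) (size b) (size c))) (grow-size b)))
    (All.map⁺ (All.map (λ {c′} e → trans (cong (λ z → size a + size b + z) e) (move₃ (size a) (size b) (size c))) (grow-size c))))
  where
  move₂ : ∀ a b c → a + (2 + b) + c ≡ 2 + (a + b + c)
  move₂ = solve-∀
  move₃ : ∀ a b c → a + b + (2 + c) ≡ 2 + (a + b + c)
  move₃ = solve-∀

∑-grow-size : ∀ t (f : ℕ → Shape → ℕ) →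
  (∑[ t′ ← grow t ] f (size t′) t′) ≡ (∑[ t′ ← grow t ] f (2 + size t) t′)
∑-grow-size t f = ∑-congAll (All.map (λ {t′} e → cong (λ z → f z t′) e) (grow-size t))

-- Eigenfunctions of uniform growth

-- q is multiplied on average by 1 + c / size in a growth step.
Eigen : ℕ → (Shape → ℕ) → Set
Eigen c q = ∀ t → ∑ (grow t) q ≡ (size t + c) * q t

-- The product n (n + 2) (n + 4) ... of k factors; `rise 1 k` is the double factorial (2k - 1)!!,
-- the number of histories of k steps.
rise : ℕ → ℕ → ℕ
rise n zero = 1
rise n (suc k) = n * rise (2 + n) k

rise-+ : ∀ n j k → rise n (j + k) ≡ rise n j * rise (n + 2 * j) k
rise-+ n zero k = trans (cong (λ z → rise z k) (sym (+-identityʳ n))) (sym (*-identityˡ _))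
rise-+ n (suc j) k = begin
  n * rise (2 + n) (j + k)                           ≡⟨ cong (n *_) (rise-+ (2 + n) j k) ⟩
  n * (rise (2 + n) j * rise (2 + n + 2 * j) k)      ≡⟨ *-assoc n _ _ ⟨
  n * rise (2 + n) j * rise (2 + n + 2 * j) k        ≡⟨ cong (λ z → n * rise (2 + n) j * rise z k) (shift n j) ⟩
  n * rise (2 + n) j * rise (n + 2 * suc j) k        ∎
  where
  open ≡-Reasoning
  shift : ∀ n j → 2 + n + 2 * j ≡ n + 2 * suc j
  shift = solve-∀

rise-≥ : ∀ n k → n ^ k ≤ rise n k
rise-≥ n k = go n n k ≤-refl
  where
  go : ∀ m n k → m ≤ n → m ^ k ≤ rise n k
  go m n zero p = ≤-refl
  go m n (suc k) p = *-mono-≤ p (go m (2 + n) k (≤-trans p (m≤n+m n 2)))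

-- Every insertion adds two faces wherever it happens, so the successive eigenvalues are
-- deterministic.
walks-Eigen : ∀ {c q} → Eigen c q → ∀ k t → walks grow k q t ≡ rise (size t + c) k * q t
walks-Eigen e zero t = sym (*-identityˡ _)
walks-Eigen {c} {q} e (suc k) t = begin
  ∑ (grow t) (walks grow k q)                              ≡⟨ ∑-cong (grow t) (walks-Eigen e k) ⟩
  (∑[ t′ ← grow t ] rise (size t′ + c) k * q t′)           ≡⟨ ∑-grow-size t (λ z t′ → rise (z + c) k * q t′) ⟩
  (∑[ t′ ← grow t ] rise (2 + size t + c) k * q t′)        ≡⟨ ∑-* (grow t) (rise (2 + size t + c) k) q ⟩
  rise (2 + size t + c) k * ∑ (grow t) q                   ≡⟨ cong (rise (2 + size t + c) k *_) (e t) ⟩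
  rise (2 + size t + c) k * ((size t + c) * q t)           ≡⟨ rearrange (rise (2 + size t + c) k) (size t + c) (q t) ⟩
  (size t + c) * rise (2 + (size t + c)) k * q t           ∎
  where
  open ≡-Reasoning
  rearrange : ∀ a b c → a * (b * c) ≡ b * a * c
  rearrange = solve-∀

Eigen-one : Eigen 0 (λ _ → 1)
Eigen-one leaf = refl
Eigen-one (node _ a b c) = trans (∑-grow-node a b c _)
  (trans (cong₂ _+_ (Eigen-one a) (cong₂ _+_ (Eigen-one b) (Eigen-one c)))
    (rearrange (size a) (size b) (size c)))
  where
  rearrange : ∀ a b c → (a + 0) * 1 + ((b + 0) * 1 + (c + 0) * 1) ≡ (a + b + c + 0) * 1
  rearrange = solve-∀

Eigen-size : Eigen 2 size
Eigen-size t = begin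
  ∑ (grow t) size                        ≡⟨ ∑-grow-size t (λ z _ → z) ⟩
  (∑[ _ ← grow t ] 2 + size t)           ≡⟨ ∑-cong (grow t) (λ _ → sym (*-identityʳ (2 + size t))) ⟩
  (∑[ _ ← grow t ] (2 + size t) * 1)     ≡⟨ ∑-* (grow t) (2 + size t) (λ _ → 1) ⟩
  (2 + size t) * ∑ (grow t) (λ _ → 1)    ≡⟨ cong ((2 + size t) *_) (Eigen-one t) ⟩
  (2 + size t) * ((size t + 0) * 1)      ≡⟨ rearrange (size t) ⟩
  (size t + 2) * size t                  ∎
  where
  open ≡-Reasoning
  rearrange : ∀ n → (2 + n) * ((n + 0) * 1) ≡ (n + 2) * n
  rearrange = solve-∀

-- A growth step changes one of the three factors, so eigenvalues obey a product rule and the shifts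
-- of eigenfunctions add up.
prod₃ : ℕ → (Shape → ℕ) → Shape → ℕ
prod₃ w q leaf = 1
prod₃ w q (node _ a b c) = w * (q a * q b * q c)

-- The value 1 at a leaf forces the factor: there the eigenvalue is 1 + 3 c,
-- and the only successor is a node of three leaves.
Eigen-prod₃ : ∀ {c q} → Eigen c q → q leaf ≡ 1 → Eigen (3 * c) (prod₃ (1 + 3 * c) q)
Eigen-prod₃ {c} e q₁ leaf rewrite q₁ = +-identityʳ _
Eigen-prod₃ {k} {q} e q₁ (node _ a b c) = begin
  ∑ (grow (node′ a b c)) (prod₃ w q)
    ≡⟨ ∑-grow-node a b c _ ⟩
  (∑[ a′ ← grow a ] w * (q a′ * q b * q c)) +
  ((∑[ b′ ← grow b ] w * (q a * q b′ * q c)) + (∑[ c′ ← grow c ] w * (q a * q b * q c′)))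
    ≡⟨ cong₂ _+_ (pull a (w * q b * q c) (λ z → order₁ w z (q b) (q c)))
         (cong₂ _+_ (pull b (w * q a * q c) (λ z → order₂ w (q a) z (q c)))
                    (pull c (w * q a * q b) (λ z → order₃ w (q a) (q b) z))) ⟩
  w * q b * q c * ((size a + k) * q a) +
  (w * q a * q c * ((size b + k) * q b) + w * q a * q b * ((size c + k) * q c))
    ≡⟨ collect w (q a) (q b) (q c) (size a) (size b) (size c) k ⟩
  (size a + size b + size c + 3 * k) * (w * (q a * q b * q c)) ∎
  where
  open ≡-Reasoning
  w = 1 + 3 * k
  pull : ∀ t v {g : ℕ → ℕ} → (∀ z → g z ≡ v * z) → ∑ (grow t) (g ∘ q) ≡ v * ((size t + k) * q t)
  pull t v h = trans (∑-cong (grow t) (λ t′ → h (q t′)))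
    (trans (∑-* (grow t) v q) (cong (v *_) (e t)))
  order₁ : ∀ w a b c → w * (a * b * c) ≡ w * b * c * a
  order₁ = solve-∀
  order₂ : ∀ w a b c → w * (a * b * c) ≡ w * a * c * b
  order₂ = solve-∀
  order₃ : ∀ w a b c → w * (a * b * c) ≡ w * a * b * c
  order₃ = solve-∀
  collect : ∀ w qa qb qc a b c k →
    w * qb * qc * ((a + k) * qa) + (w * qa * qc * ((b + k) * qb) + w * qa * qb * ((c + k) * qc))
    ≡ (a + b + c + 3 * k) * (w * (qa * qb * qc))
  collect = solve-∀

-- Balanced trees

indicator : {P : Set} → Dec P → ℕ
indicator (yes _) = 1
indicator (no _) = 0

moment-shift : ℕ → ℕ
moment-shift zero = 2
moment-shift (suc i) = 3 * moment-shift i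

-- Up to a constant, the product of the sizes of the 3 ^ i subtrees at depth i.
moment : ℕ → Shape → ℕ
moment zero = size
moment (suc i) = prod₃ (1 + moment-shift (suc i)) (moment i)

moment-leaf : ∀ i → moment i leaf ≡ 1
moment-leaf zero = refl
moment-leaf (suc i) = refl

Eigen-moment : ∀ i → Eigen (moment-shift i) (moment i)
Eigen-moment zero = Eigen-size
Eigen-moment (suc i) = Eigen-prod₃ (Eigen-moment i) (moment-leaf i)

01-* : ∀ {b c} → b ≡ 0 ⊎ b ≡ 1 → c ≡ 0 ⊎ c ≡ 1 → b * c ≡ 0 ⊎ b * c ≡ 1
01-* (inj₁ refl) _ = inj₁ refl
01-* (inj₂ refl) (inj₁ refl) = inj₁ refl
01-* (inj₂ refl) (inj₂ refl) = inj₂ refl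

-- The value `moment i` would take if every subtree at depth i had N faces: a crude upper bound, but
-- of the right order in N.
cap : ℕ → ℕ → ℕ
cap N zero = N
cap N (suc i) = (1 + moment-shift (suc i)) * (cap N i * cap N i * cap N i)

module _ (M N : ℕ) where

  -- `N` is a parameter because every subtree is compared with the size of the root, not with that
  -- of its parent. A tree with a leaf above depth i counts as unbalanced.
  balanced : ℕ → Shape → ℕ
  balanced zero t = indicator (N ≤? M * size t)
  balanced (suc i) leaf = 0
  balanced (suc i) (node _ a b c) = balanced i a * balanced i b * balanced i c

  balanced-01 : ∀ i t → balanced i t ≡ 0 ⊎ balanced i t ≡ 1
  balanced-01 zero t with N ≤? M * size t
  ... | yes _ = inj₂ refl
  ... | no _ = inj₁ refl
  balanced-01 (suc i) leaf = inj₁ refl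
  balanced-01 (suc i) (node _ a b c) =
    01-* (01-* (balanced-01 i a) (balanced-01 i b)) (balanced-01 i c)

  -- For b = 0 the slack says that u is at most a fraction 1 / M of D. It is written as one
  -- inequality linear in b so that it can be summed over walks.
  record Capped (u D b : ℕ) : Set where
    constructor capped
    field
      bound : u ≤ D
      slack : M * u ≤ D * (M * b + 1)

  -- One small factor is enough: if b = 0 the first factor supplies the gain and the second its
  -- crude bound, otherwise the roles are exchanged.
  Capped-* : ∀ {u v D E b c} → b ≡ 0 ⊎ b ≡ 1 → Capped u D b → Capped v E c →
    Capped (u * v) (D * E) (b * c)
  Capped-* {u} {v} {D} {E} {b} {c} b01 (capped p m) (capped q n) =
    capped (*-mono-≤ p q) (slack b01 m)
    where
    open ≤-Reasoning
    slack : b ≡ 0 ⊎ b ≡ 1 → M * u ≤ D * (M * b + 1) → M * (u * v) ≤ D * E * (M * (b * c) + 1)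
    slack (inj₁ refl) m = begin
      M * (u * v)                    ≡⟨ *-assoc M u v ⟨
      M * u * v                      ≤⟨ *-mono-≤ m q ⟩
      D * (M * 0 + 1) * E            ≡⟨ rearrange D E (M * 0 + 1) ⟩
      D * E * (M * 0 + 1)            ∎
      where
      rearrange : ∀ d e m → d * m * e ≡ d * e * m
      rearrange = solve-∀
    slack (inj₂ refl) _ = begin
      M * (u * v)                    ≡⟨ rearrange M u v ⟩
      u * (M * v)                    ≤⟨ *-mono-≤ p n ⟩
      D * (E * (M * c + 1))          ≡⟨ *-assoc D E _ ⟨
      D * E * (M * c + 1)            ≡⟨ cong (λ z → D * E * (M * z + 1)) (*-identityˡ c) ⟨
      D * E * (M * (1 * c) + 1)      ∎
      where
      rearrange : ∀ m u v → m * (u * v) ≡ u * (m * v)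
      rearrange = solve-∀

  Capped-scale : ∀ {u D b} w → Capped u D b → Capped (w * u) (w * D) b
  Capped-scale {u} {D} {b} w (capped p m) = capped (*-monoʳ-≤ w p) (begin
    M * (w * u)            ≡⟨ rearrange M w u ⟩
    w * (M * u)            ≤⟨ *-monoʳ-≤ w m ⟩
    w * (D * (M * b + 1))  ≡⟨ *-assoc w D _ ⟨
    w * D * (M * b + 1)    ∎)
    where
    open ≤-Reasoning
    rearrange : ∀ m u v → m * (u * v) ≡ u * (m * v)
    rearrange = solve-∀

  module _ (1≤N : 1 ≤ N) (M≤N : M ≤ N) where

    N≤cap : ∀ i → N ≤ cap N i
    N≤cap zero = ≤-refl
    N≤cap (suc i) = begin
      N                          ≤⟨ N≤cap i ⟩
      cap N i                      ≡⟨ *-identityˡ _ ⟨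
      1 * cap N i                  ≡⟨ *-identityˡ _ ⟨
      1 * (1 * cap N i)            ≤⟨ *-mono-≤ {1} {1 + moment-shift (suc i)} (s≤s z≤n)
                                      (*-monoˡ-≤ (cap N i) (*-mono-≤ {1} {cap N i} {1} {cap N i} 1≤cap 1≤cap)) ⟩
      cap N (suc i)                ∎
      where
      open ≤-Reasoning
      1≤cap = ≤-trans 1≤N (N≤cap i)

    moment-capped : ∀ i t → size t ≤ N → Capped (moment i t) (cap N i) (balanced i t)
    moment-capped zero t p = capped p (slack (N ≤? M * size t))
      where
      slack : (d : Dec (N ≤ M * size t)) → M * size t ≤ N * (M * indicator d + 1)
      slack (yes _) = begin
        M * size t         ≤⟨ *-monoʳ-≤ M p ⟩
        M * N              ≤⟨ m≤m+n (M * N) N ⟩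
        M * N + N          ≡⟨ rearrange M N ⟩
        N * (M * 1 + 1)    ∎
        where
        open ≤-Reasoning
        rearrange : ∀ m n → m * n + n ≡ n * (m * 1 + 1)
        rearrange = solve-∀
      slack (no ¬q) = begin
        M * size t         ≤⟨ <⇒≤ (≰⇒> ¬q) ⟩
        N                  ≡⟨ rearrange M N ⟩
        N * (M * 0 + 1)    ∎
        where
        open ≤-Reasoning
        rearrange : ∀ m n → n ≡ n * (m * 0 + 1)
        rearrange = solve-∀
    -- A leaf is unbalanced, so its moment 1 must be at most `cap N (suc i)` divided by M; this is
    -- where `M ≤ N` enters.
    moment-capped (suc i) leaf _ = capped (≤-trans 1≤N (N≤cap (suc i))) (begin
      M * 1                       ≡⟨ *-identityʳ M ⟩
      M                           ≤⟨ ≤-trans M≤N (N≤cap (suc i)) ⟩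
      cap N (suc i)                 ≡⟨ *-identityʳ _ ⟨
      cap N (suc i) * 1             ≡⟨ cong (λ z → cap N (suc i) * (z + 1)) (*-zeroʳ M) ⟨
      cap N (suc i) * (M * 0 + 1)   ∎)
      where open ≤-Reasoning
    moment-capped (suc i) (node _ a b c) p =
      Capped-scale (1 + moment-shift (suc i))
        (Capped-* (01-* (balanced-01 i a) (balanced-01 i b))
          (Capped-* (balanced-01 i a)
            (moment-capped i a (≤-trans (≤-trans (m≤m+n _ _) (m≤m+n _ _)) p))
            (moment-capped i b (≤-trans (≤-trans (m≤n+m _ (size a)) (m≤m+n _ _)) p)))
          (moment-capped i c (≤-trans (m≤n+m _ (size a + size b)) p)))

-- How often a uniform tree is balanced

walks-mono-size : ∀ k t {f g : Shape → ℕ} →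
  (∀ t′ → size t′ ≡ 2 * k + size t → f t′ ≤ g t′) → walks grow k f t ≤ walks grow k g t
walks-mono-size zero t p = p t refl
walks-mono-size (suc k) t p = ∑-monoAll (All.map (λ {t′} e → walks-mono-size k t′
    (λ t″ e′ → p t″ (trans e′ (trans (cong (2 * k +_) e) (shift k (size t)))))) (grow-size t))
  where
  shift : ∀ k n → 2 * k + (2 + n) ≡ 2 * suc k + n
  shift = solve-∀

walks-mono-leaf : ∀ k {f g : Shape → ℕ} →
  (∀ t → size t ≡ 1 + 2 * k → f t ≤ g t) → walks grow k f leaf ≤ walks grow k g leaf
walks-mono-leaf k p = walks-mono-size k leaf (λ t e → p t (trans e (+-comm (2 * k) 1)))

walks-cong-leaf : ∀ k {f g : Shape → ℕ} →
  (∀ t → size t ≡ 1 + 2 * k → f t ≡ g t) → walks grow k f leaf ≡ walks grow k g leaf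
walks-cong-leaf k p =
  ≤-antisym (walks-mono-leaf k (λ t e → ≤-reflexive (p t e)))
            (walks-mono-leaf k (λ t e → ≤-reflexive (sym (p t e))))

total-walks : ∀ k → walks grow k (λ _ → 1) leaf ≡ rise 1 k
total-walks k = trans (walks-Eigen Eigen-one k leaf) (*-identityʳ _)

walks-of-size : ∀ k (g : ℕ → ℕ) → walks grow k (λ t → g (size t)) leaf ≡ g (1 + 2 * k) * rise 1 k
walks-of-size k g = begin
  walks grow k (λ t → g (size t)) leaf
    ≡⟨ walks-cong-leaf k (λ t e → trans (cong g e) (sym (*-identityʳ _))) ⟩
  walks grow k (λ _ → g (1 + 2 * k) * 1) leaf
    ≡⟨ walks-* grow k (g (1 + 2 * k)) (λ _ → 1) leaf ⟩
  g (1 + 2 * k) * walks grow k (λ _ → 1) leaf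
    ≡⟨ cong (g (1 + 2 * k) *_) (total-walks k) ⟩
  g (1 + 2 * k) * rise 1 k ∎
  where open ≡-Reasoning

-- The constants are abstract because unfolding a product with one of them
-- would unfold its unary representation.
abstract
  R₀ c₀ : ℕ
  R₀ = rise 1 9
  c₀ = 19 * (7 * 7 * 7)

  R₀≡ : R₀ ≡ rise 1 9
  R₀≡ = refl

  -- 7 = 1 + 6 and 19 = 1 + 18 are the factors that `prod₃` needs at the two levels; the 7 occurs
  -- once for each child.
  cap₂ : ∀ N → cap N 2 ≡ c₀ * N ^ 9
  cap₂ N = trans (pull 19 7 (N * N * N)) (cong (19 * (7 * 7 * 7) *_) ninth)
    where
    pull : ∀ a b n → a * (b * n * (b * n) * (b * n)) ≡ a * (b * b * b) * (n * n * n)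
    pull = solve-∀
    cube : ∀ n → n * n * n ≡ n ^ 3
    cube n = trans (*-assoc n n n) (cong (λ z → n * (n * z)) (sym (*-identityʳ n)))
    ninth : N * N * N * (N * N * N) * (N * N * N) ≡ N ^ 9
    ninth = trans (cong (λ z → z * z * z) (cube N)) (trans (cube (N ^ 3)) (^-*-assoc N 3 3))

-- Both sides are `rise 1 (j + k)`, cut after j or after k factors.
rise-comm : ∀ j k {R n} → R ≡ rise 1 j → n ≡ 1 + 2 * j → R * rise n k ≡ rise 1 k * rise (1 + 2 * k) j
rise-comm j k refl refl =
  trans (sym (rise-+ 1 j k)) (trans (cong (rise 1) (+-comm j k)) (rise-+ 1 k j))

-- The shift 18 makes the count `rise 19 k`; `R₀` supplies the nine missing factors 1, 3, ..., 17.
-- The average of `moment 2` is thus N (N + 2) ... (N + 16) / `R₀` with N = 1 + 2 k.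
walks-moment₂ : ∀ k → R₀ * walks grow k (moment 2) leaf ≡ rise 1 k * rise (1 + 2 * k) 9
walks-moment₂ k =
  trans (cong (R₀ *_) (trans (walks-Eigen (Eigen-moment 2) k leaf) (*-identityʳ _)))
        (rise-comm 9 k R₀≡ refl)

-- With e the moment of a uniform walk, b its number of balanced end points and
-- z its number of end points.
second-moment-arith : ∀ R c n r M z b e .{{_ : NonZero M}} .{{_ : NonZero n}} →
  2 * (R * c) ≤ M → n ≤ r → R * e ≡ z * r → M * e ≤ c * n * (M * b + z) → z ≤ M * b
second-moment-arith R c n r M z b e large n≤r eq bound =
  *-cancelˡ-≤ M (+-cancelʳ-≤ (M * z) (M * z) (M * (M * b)) doubled)
  where
  open ≤-Reasoning
  scaled : n * (M * z) ≤ n * (R * c * (M * b + z))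
  scaled = begin
    n * (M * z)                      ≤⟨ *-monoˡ-≤ (M * z) n≤r ⟩
    r * (M * z)                      ≡⟨ r₁ r M z ⟩
    M * (z * r)                      ≡⟨ cong (M *_) eq ⟨
    M * (R * e)                      ≡⟨ r₂ M R e ⟩
    R * (M * e)                      ≤⟨ *-monoʳ-≤ R bound ⟩
    R * (c * n * (M * b + z))        ≡⟨ r₃ R c n (M * b + z) ⟩
    n * (R * c * (M * b + z))        ∎
    where
    r₁ : ∀ r m z → r * (m * z) ≡ m * (z * r)
    r₁ = solve-∀
    r₂ : ∀ m r e → m * (r * e) ≡ r * (m * e)
    r₂ = solve-∀
    r₃ : ∀ r c n x → r * (c * n * x) ≡ n * (r * c * x)
    r₃ = solve-∀
  -- Since 2 R c is at most M, the z on the right can account for only half of the left side.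
  doubled : M * z + M * z ≤ M * (M * b) + M * z
  doubled = begin
    M * z + M * z                    ≡⟨ cong (M * z +_) (+-identityʳ (M * z)) ⟨
    2 * (M * z)                      ≤⟨ *-monoʳ-≤ 2 (*-cancelˡ-≤ n scaled) ⟩
    2 * (R * c * (M * b + z))        ≡⟨ *-assoc 2 (R * c) _ ⟨
    2 * (R * c) * (M * b + z)        ≤⟨ *-monoˡ-≤ (M * b + z) large ⟩
    M * (M * b + z)                  ≡⟨ *-distribˡ-+ M (M * b) z ⟩
    M * (M * b) + M * z              ∎

module _ (M : ℕ) .{{_ : NonZero M}} (M-large : 2 * (R₀ * c₀) ≤ M) (k N : ℕ) .{{_ : NonZero N}}
  (N≡ : N ≡ 1 + 2 * k) (M≤N : M ≤ N) where

  private
    b = walks grow k (balanced M N 2) leaf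

  walks-moment₂-≤ : M * walks grow k (moment 2) leaf ≤ cap N 2 * (M * b + rise 1 k)
  walks-moment₂-≤ = begin
    M * walks grow k (moment 2) leaf
      ≡⟨ walks-* grow k M (moment 2) leaf ⟨
    walks grow k (λ t → M * moment 2 t) leaf
      ≤⟨ walks-mono-leaf k (λ t e → Capped.slack (moment-capped M N (>-nonZero⁻¹ N) M≤N 2 t (≤-reflexive (trans e (sym N≡))))) ⟩
    walks grow k (λ t → cap N 2 * (M * balanced M N 2 t + 1)) leaf
      ≡⟨ walks-* grow k (cap N 2) _ leaf ⟩
    cap N 2 * walks grow k (λ t → M * balanced M N 2 t + 1) leaf
      ≡⟨ cong (cap N 2 *_) (walks-+ grow k (λ t → M * balanced M N 2 t) (λ _ → 1) leaf) ⟩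
    cap N 2 * (walks grow k (λ t → M * balanced M N 2 t) leaf + walks grow k (λ _ → 1) leaf)
      ≡⟨ cong (cap N 2 *_) (cong₂ _+_ (walks-* grow k M (balanced M N 2) leaf) (total-walks k)) ⟩
    cap N 2 * (M * b + rise 1 k) ∎
    where open ≤-Reasoning

  -- A reverse Markov inequality: unbalanced trees have a moment of at most `cap N 2` / M, which for
  -- M ≥ 2 `R₀` `c₀` is at most half the average, so balanced trees must supply the rest.
  balanced-often : rise 1 k ≤ M * walks grow k (λ t → balanced M (size t) 2 t) leaf
  balanced-often = subst (λ z → rise 1 k ≤ M * z)
    (sym (walks-cong-leaf k (λ t e → cong (λ z → balanced M z 2 t) (trans e (sym N≡)))))
    (second-moment-arith R₀ c₀ (N ^ 9) (rise N 9) M (rise 1 k) b _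
      {{it}} {{m^n≢0 N 9}} M-large (rise-≥ N 9)
      (trans (walks-moment₂ k) (cong (λ z → rise 1 k * rise z 9) (sym N≡)))
      (≤-trans walks-moment₂-≤ (≤-reflexive (cong (_* (M * b + rise 1 k)) (cap₂ N)))))

-- Conditioning on subtree sizes

-- The classes are the events conditioned on: the tree above depth i together with the sizes of the
-- subtrees at depth i.
Alike : ℕ → Shape → Shape → Set
Alike zero t t′ = size t ≡ size t′
Alike (suc i) leaf leaf = ⊤
Alike (suc i) (node _ a b c) (node _ a′ b′ c′) = Alike i a a′ × Alike i b b′ × Alike i c c′
Alike (suc i) leaf (node _ _ _ _) = ⊥
Alike (suc i) (node _ _ _ _) leaf = ⊥

Alike-refl : ∀ i t → Alike i t t
Alike-refl zero t = refl
Alike-refl (suc i) leaf = tt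
Alike-refl (suc i) (node _ a b c) = Alike-refl i a , Alike-refl i b , Alike-refl i c

Alike-size : ∀ i t t′ → Alike i t t′ → size t ≡ size t′
Alike-size zero t t′ e = e
Alike-size (suc i) leaf leaf _ = refl
Alike-size (suc i) (node _ a b c) (node _ a′ b′ c′) (p , q , r) =
  cong₂ _+_ (cong₂ _+_ (Alike-size i a a′ p) (Alike-size i b b′ q)) (Alike-size i c c′ r)

Alike-balanced : ∀ M N i t t′ → Alike i t t′ → balanced M N i t ≡ balanced M N i t′
Alike-balanced M N zero t t′ e = cong (λ z → indicator (N ≤? M * z)) e
Alike-balanced M N (suc i) leaf leaf _ = refl
Alike-balanced M N (suc i) (node _ a b c) (node _ a′ b′ c′) (p , q , r) =
  cong₂ _*_ (cong₂ _*_ (Alike-balanced M N i a a′ p) (Alike-balanced M N i b b′ q))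
            (Alike-balanced M N i c c′ r)

-- Measurability with respect to the partition into `Alike i` classes.
Respects : ℕ → (Shape → ℕ) → Set
Respects i w = ∀ t t′ → Alike i t t′ → w t ≡ w t′

Triple : Set
Triple = Shape × Shape × Shape

grow₃ : Triple → List Triple
grow₃ = grow ⊗ (grow ⊗ grow)

rotate : Triple → Triple
rotate (x , y , z) = z , x , y

∑-grow₃ : ∀ x y z f → ∑ (grow₃ (x , y , z)) f ≡
  (∑[ x′ ← grow x ] f (x′ , y , z)) +
  ((∑[ y′ ← grow y ] f (x , y′ , z)) + (∑[ z′ ← grow z ] f (x , y , z′)))
∑-grow₃ x y z f = trans (∑-⊗ grow (grow ⊗ grow) x (y , z) f)
  (cong ((∑[ x′ ← grow x ] f (x′ , y , z)) +_) (∑-⊗ grow grow y z (λ p → f (x , p))))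

node₃ : Triple → Shape
node₃ (a , b , c) = node′ a b c

lumps-node₃ : Lumps grow₃ grow node₃
lumps-node₃ (a , b , c) f = trans (∑-grow-node a b c f) (sym (∑-grow₃ a b c (f ∘ node₃)))

lumps-rotate : Lumps grow₃ grow₃ rotate
lumps-rotate (x , y , z) f = begin
  ∑ (grow₃ (z , x , y)) f                  ≡⟨ ∑-grow₃ z x y f ⟩
  sz + (sx + sy)                           ≡⟨ +-comm sz (sx + sy) ⟩
  sx + sy + sz                             ≡⟨ +-assoc sx sy sz ⟩
  sx + (sy + sz)                           ≡⟨ ∑-grow₃ x y z (f ∘ rotate) ⟨
  ∑ (grow₃ (x , y , z)) (f ∘ rotate)       ∎
  where
  open ≡-Reasoning
  sx = ∑[ x′ ← grow x ] f (z , x′ , y)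
  sy = ∑[ y′ ← grow y ] f (z , x , y′)
  sz = ∑[ z′ ← grow z ] f (z′ , x , y)

-- After the first insertion the children grow as a product. Rotating the three terms of `over` puts
-- the child seen by f first, where `walks-⊗-mono` can act on it.
walks-node : ∀ k (w f : Shape → ℕ) → walks grow (suc k) (λ t → w t * over f t) leaf ≡
  walks grow₃ k (λ (x , y , z) → w (node′ x y z) * f x) (leaf , leaf , leaf) +
  walks grow₃ k (λ (x , y , z) → w (node′ z x y) * f x) (leaf , leaf , leaf) +
  walks grow₃ k (λ (x , y , z) → w (node′ y z x) * f x) (leaf , leaf , leaf)
walks-node k w f = begin
  walks grow k h (node′ leaf leaf leaf) + 0
    ≡⟨ +-identityʳ _ ⟩
  walks grow k h (node′ leaf leaf leaf)
    ≡⟨ walks-lump {s = grow₃} {φ = node₃} lumps-node₃ k h (leaf , leaf , leaf) ⟩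
  walks grow₃ k (h ∘ node₃) lll
    ≡⟨ walks-cong grow₃ k (λ (x , y , z) → distrib (w (node′ x y z)) (f x) (f y) (f z)) lll ⟩
  walks grow₃ k (λ p → h₁ p + h₂ p + h₃ p) lll
    ≡⟨ walks-+ grow₃ k (λ p → h₁ p + h₂ p) h₃ lll ⟩
  walks grow₃ k (λ p → h₁ p + h₂ p) lll + walks grow₃ k h₃ lll
    ≡⟨ cong (_+ walks grow₃ k h₃ lll) (walks-+ grow₃ k h₁ h₂ lll) ⟩
  walks grow₃ k h₁ lll + walks grow₃ k h₂ lll + walks grow₃ k h₃ lll
    ≡⟨ cong₂ (λ u v → walks grow₃ k h₁ lll + u + v)
         (turn h₂)
         (trans (turn h₃) (turn (h₃ ∘ rotate))) ⟩
  walks grow₃ k h₁ lll + walks grow₃ k (h₂ ∘ rotate) lll + walks grow₃ k (h₃ ∘ rotate ∘ rotate) lll ∎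
  where
  open ≡-Reasoning
  lll : Triple
  lll = leaf , leaf , leaf
  h = λ t → w t * over f t
  h₁ h₂ h₃ : Triple → ℕ
  h₁ (x , y , z) = w (node′ x y z) * f x
  h₂ (x , y , z) = w (node′ x y z) * f y
  h₃ (x , y , z) = w (node′ x y z) * f z
  turn : ∀ f → walks grow₃ k f lll ≡ walks grow₃ k (f ∘ rotate) lll
  turn f = walks-lump {s = grow₃} {φ = rotate} lumps-rotate k f lll
  distrib : ∀ w a b c → w * (a + b + c) ≡ w * a + w * b + w * c
  distrib = solve-∀

-- Given the sizes of the subtrees at depth i, these subtrees are independent
-- and each is uniform for its own size.
walks-conditional : ∀ i {f g : Shape → ℕ} →
  (∀ k → walks grow k f leaf ≤ walks grow k g leaf) →
  ∀ w → Respects i w → ∀ k →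
  walks grow k (λ t → w t * over^ i f t) leaf ≤ walks grow k (λ t → w t * over^ i g t) leaf
walks-conditional zero {f} {g} dom w resp k = begin
  walks grow k (λ t → w t * f t) leaf    ≡⟨ const f ⟩
  w (comb k) * walks grow k f leaf       ≤⟨ *-monoʳ-≤ (w (comb k)) (dom k) ⟩
  w (comb k) * walks grow k g leaf       ≡⟨ const g ⟨
  walks grow k (λ t → w t * g t) leaf    ∎
  where
  open ≤-Reasoning
  -- At depth 0 the weight depends on the size only; the comb is an arbitrary tree of the right size
  -- at which to evaluate it.
  comb : ℕ → Shape
  comb zero = leaf
  comb (suc k) = node′ leaf leaf (comb k)
  size-comb : ∀ k → size (comb k) ≡ 1 + 2 * k
  size-comb zero = refl
  size-comb (suc k) = trans (cong (2 +_) (size-comb k)) (shift k)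
    where
    shift : ∀ k → 2 + (1 + 2 * k) ≡ 1 + 2 * suc k
    shift = solve-∀
  const : ∀ h → walks grow k (λ t → w t * h t) leaf ≡ w (comb k) * walks grow k h leaf
  const h = trans
    (walks-cong-leaf k (λ t e → cong (_* h t) (resp t (comb k) (trans e (sym (size-comb k))))))
    (walks-* grow k (w (comb k)) h leaf)
walks-conditional (suc i) {f} {g} dom w resp zero = *-monoʳ-≤ (w leaf) (at-leaf (suc i))
  where
  at-leaf : ∀ i → over^ i f leaf ≤ over^ i g leaf
  at-leaf zero = dom 0
  at-leaf (suc i) = at-leaf i
walks-conditional (suc i) {f} {g} dom w resp (suc k)
  rewrite walks-node k w (over^ i f) | walks-node k w (over^ i g) =
  +-mono-≤ (+-mono-≤
    (first node′ (λ y z t t′ s → resp _ _ (s , Alike-refl i y , Alike-refl i z)))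
    (first (λ x y z → node′ z x y) (λ y z t t′ s → resp _ _ (Alike-refl i z , s , Alike-refl i y))))
    (first (λ x y z → node′ y z x) (λ y z t t′ s → resp _ _ (Alike-refl i y , Alike-refl i z , s)))
  where
  first : (n : Shape → Shape → Shape → Shape) → (∀ y z → Respects i (λ x → w (n x y z))) →
    walks grow₃ k (λ (x , y , z) → w (n x y z) * over^ i f x) (leaf , leaf , leaf) ≤
    walks grow₃ k (λ (x , y , z) → w (n x y z) * over^ i g x) (leaf , leaf , leaf)
  -- With the other two subtrees frozen, the chosen one has made j free insertions and the induction
  -- applies to the weight as a function of it alone.
  first n r = walks-⊗-mono grow (grow ⊗ grow) leaf
    (λ j (y , z) → walks-conditional i dom (λ x → w (n x y z)) (r y z) j) k (leaf , leaf)

-- The potential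

over-mono : ∀ {f g : Tree L → ℕ} → (∀ t → f t ≤ g t) → ∀ t → over f t ≤ over g t
over-mono p leaf = p leaf
over-mono p (node _ a b c) = +-mono-≤ (+-mono-≤ (p a) (p b)) (p c)

over^-* : ∀ i k (f : Tree L → ℕ) t → over^ i (λ t → k * f t) t ≡ k * over^ i f t
over^-* zero k f t = refl
over^-* (suc i) k f leaf = over^-* i k f leaf
over^-* (suc i) k f (node _ a b c)
  rewrite over^-* i k f a | over^-* i k f b | over^-* i k f c =
  distrib k (over^ i f a) (over^ i f b) (over^ i f c)
  where
  distrib : ∀ k a b c → k * a + k * b + k * c ≡ k * (a + b + c)
  distrib = solve-∀

-- The sizes at depth i add up to the size of t, and there are at most 3 ^ i subtrees to contribute
-- a c.
over^-affine : ∀ i k c (t : Tree L) → over^ i (λ t → k * size t + c) t ≤ k * size t + 3 ^ i * c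
over^-affine zero k c t = ≤-reflexive (cong (k * size t +_) (sym (*-identityˡ c)))
over^-affine {L} (suc i) k c t = ≤-trans (over-mono (over^-affine i k c) t) (one t)
  where
  open ≤-Reasoning
  one : (t : Tree L) → over (λ t → k * size t + 3 ^ i * c) t ≤ k * size t + 3 ^ suc i * c
  one leaf = +-monoʳ-≤ (k * 1) (*-monoˡ-≤ c (m≤m+n (3 ^ i) _))
  one (node _ x y z) = ≤-reflexive (collect k (3 ^ i) c (size x) (size y) (size z))
    where
    collect : ∀ k p c x y z → k * x + p * c + (k * y + p * c) + (k * z + p * c) ≡
      k * (x + y + z) + (3 * p) * c
    collect = solve-∀

module Potential (m : ℕ) where

  -- `B` is M² - 1 without subtraction, and `suc B` computes to `M * M`. The decay per double level
  -- is B / M² = 1 - 1 / M².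
  M B : ℕ
  M = suc m
  B = m + m * M

  bal weight : Shape → ℕ
  bal t = balanced M (size t) 2 t
  weight t = m + (1 ∸ bal t)

  -- Bounds the faces a path can visit, at depth 2 d: the weight M - 1 of a
  -- balanced node, relative to M, accounts for the lost grandchild.
  Ψ : ℕ → Shape → ℕ
  Ψ zero = size
  Ψ (suc d) t = weight t * over^ 2 (Ψ d) t

  weight+bal : ∀ t → weight t + bal t ≡ M
  weight+bal t with bal t | balanced-01 M (size t) 2 t
  ... | _ | inj₁ refl = trans (+-identityʳ _) (+-comm m 1)
  ... | _ | inj₂ refl = trans (cong (_+ 1) (+-identityʳ m)) (+-comm m 1)

  Respects-weight : Respects 2 weight
  Respects-weight t t′ s rewrite Alike-size 2 t t′ s | Alike-balanced M (size t′) 2 t t′ s = refl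

  -- The error caused by trees with fewer than M faces, for which balance is not guaranteed: one new
  -- term per level, plus the errors of the nine grandchildren.
  offset : ℕ → ℕ
  offset zero = 0
  offset (suc d) = B ^ d * M + suc B * (9 * offset d)

  module _ (often : ∀ k → M ≤ 1 + 2 * k → rise 1 k ≤ M * walks grow k bal leaf) where

    walks-weight : ∀ k → M * walks grow k weight leaf + M * walks grow k bal leaf ≡ rise 1 k + B * rise 1 k
    walks-weight k = begin
      M * walks grow k weight leaf + M * walks grow k bal leaf
        ≡⟨ *-distribˡ-+ M (walks grow k weight leaf) _ ⟨
      M * (walks grow k weight leaf + walks grow k bal leaf)
        ≡⟨ cong (M *_) (walks-+ grow k weight bal leaf) ⟨
      M * walks grow k (λ t → weight t + bal t) leaf
        ≡⟨ cong (M *_) (walks-cong grow k (λ t → trans (weight+bal t) (sym (*-identityʳ M))) leaf) ⟩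
      M * walks grow k (λ t → M * 1) leaf
        ≡⟨ cong (M *_) (trans (walks-* grow k M (λ _ → 1) leaf) (cong (M *_) (total-walks k))) ⟩
      M * (M * rise 1 k)
        ≡⟨ *-assoc M M _ ⟨
      rise 1 k + B * rise 1 k ∎
      where open ≡-Reasoning

    -- From M faces on, `often` lowers the average weight, scaled by M, from M² to B. Below that
    -- only M² is available, and the excess a N is less than a M.
    step-arith : ∀ k a c → (a * (1 + 2 * k) + c) * (M * walks grow k weight leaf) ≤
      (B * a * (1 + 2 * k) + (a * M + suc B * c)) * rise 1 k
    step-arith k a c with M ≤? 1 + 2 * k
    ... | yes M≤N = ≤-trans (*-monoʳ-≤ (a * N + c) large) (m+n≤o⇒m≤o _ (≤-reflexive (split a c N M B Z)))
      where
      N = 1 + 2 * k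
      Z = rise 1 k
      large : M * walks grow k weight leaf ≤ B * Z
      large = +-cancelʳ-≤ Z _ _ (begin
        M * walks grow k weight leaf + Z
          ≤⟨ +-monoʳ-≤ (M * walks grow k weight leaf) (often k M≤N) ⟩
        M * walks grow k weight leaf + M * walks grow k bal leaf
          ≡⟨ trans (walks-weight k) (+-comm Z _) ⟩
        B * Z + Z ∎)
        where open ≤-Reasoning
      split : ∀ a c n m b z → (a * n + c) * (b * z) + (a * m * z + c * z) ≡
        (b * a * n + (a * m + (1 + b) * c)) * z
      split = solve-∀
    ... | no M≰N = begin
      (a * N + c) * (M * walks grow k weight leaf)
        ≤⟨ *-monoʳ-≤ (a * N + c) (≤-trans (m≤m+n _ _) (≤-reflexive (walks-weight k))) ⟩
      (a * N + c) * (Z + B * Z)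
        ≡⟨ split a c N B Z ⟩
      (B * a * N + (a * N + suc B * c)) * Z
        ≤⟨ *-monoˡ-≤ Z (+-monoʳ-≤ (B * a * N) (+-monoˡ-≤ (suc B * c) (*-monoʳ-≤ a (<⇒≤ (≰⇒> M≰N))))) ⟩
      (B * a * N + (a * M + suc B * c)) * Z ∎
      where
      open ≤-Reasoning
      N = 1 + 2 * k
      Z = rise 1 k
      split : ∀ a c n b z → (a * n + c) * (z + b * z) ≡ (b * a * n + (a * n + (1 + b) * c)) * z
      split = solve-∀

    -- One factor M ^ d is built into the weights of `Ψ`, the other clears the probabilities 1 / M:
    -- up to a constant, the average of `Ψ d` / M ^ d is at most (B / M²) ^ d times the size.
    walks-Ψ : ∀ d k → M ^ d * walks grow k (Ψ d) leaf ≤ (B ^ d * (1 + 2 * k) + offset d) * rise 1 k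
    walks-Ψ zero k = ≤-reflexive (begin
      1 * walks grow k size leaf              ≡⟨ *-identityˡ _ ⟩
      walks grow k size leaf                  ≡⟨ walks-of-size k id ⟩
      (1 + 2 * k) * rise 1 k                  ≡⟨ cong (_* rise 1 k) (tidy (1 + 2 * k)) ⟩
      (1 * (1 + 2 * k) + 0) * rise 1 k        ∎)
      where
      open ≡-Reasoning
      tidy : ∀ n → n ≡ 1 * n + 0
      tidy = solve-∀
    walks-Ψ (suc d) k = begin
      M ^ suc d * walks grow k (Ψ (suc d)) leaf
        ≡⟨ *-assoc M (M ^ d) _ ⟩
      M * (M ^ d * walks grow k (Ψ (suc d)) leaf)
        ≡⟨ cong (M *_) (walks-* grow k (M ^ d) (Ψ (suc d)) leaf) ⟨
      M * walks grow k (λ t → M ^ d * (weight t * over^ 2 (Ψ d) t)) leaf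
        ≡⟨ cong (M *_) (walks-cong grow k (λ t → trans (exchange (M ^ d) (weight t) _)
             (cong (weight t *_) (sym (over^-* 2 (M ^ d) (Ψ d) t)))) leaf) ⟩
      M * walks grow k (λ t → weight t * over^ 2 (λ t → M ^ d * Ψ d t) t) leaf
        -- `weight` depends only on the sizes of the grandchildren, so given these the potential of
        -- each may be replaced by its affine bound.
        ≤⟨ *-monoʳ-≤ M (walks-conditional 2 dominated weight Respects-weight k) ⟩
      M * walks grow k (λ t → weight t * over^ 2 (λ t → B ^ d * size t + offset d) t) leaf
        ≤⟨ *-monoʳ-≤ M (walks-mono grow k (λ t → *-monoʳ-≤ (weight t) (over^-affine 2 (B ^ d) (offset d) t)) leaf) ⟩
      M * walks grow k (λ t → weight t * (B ^ d * size t + 9 * offset d)) leaf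
        ≡⟨ cong (M *_) (walks-cong-leaf k (λ t e → trans (*-comm (weight t) _)
             (cong (λ z → (B ^ d * z + 9 * offset d) * weight t) e))) ⟩
      M * walks grow k (λ t → (B ^ d * (1 + 2 * k) + 9 * offset d) * weight t) leaf
        ≡⟨ cong (M *_) (walks-* grow k (B ^ d * (1 + 2 * k) + 9 * offset d) weight leaf) ⟩
      M * ((B ^ d * (1 + 2 * k) + 9 * offset d) * walks grow k weight leaf)
        ≡⟨ exchange M (B ^ d * (1 + 2 * k) + 9 * offset d) _ ⟩
      (B ^ d * (1 + 2 * k) + 9 * offset d) * (M * walks grow k weight leaf)
        ≤⟨ step-arith k (B ^ d) (9 * offset d) ⟩
      (B ^ suc d * (1 + 2 * k) + offset (suc d)) * rise 1 k ∎
      where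
      open ≤-Reasoning
      exchange : ∀ a b c → a * (b * c) ≡ b * (a * c)
      exchange = solve-∀
      dominated : ∀ k → walks grow k (λ t → M ^ d * Ψ d t) leaf ≤
                        walks grow k (λ t → B ^ d * size t + offset d) leaf
      dominated k = begin
        walks grow k (λ t → M ^ d * Ψ d t) leaf             ≡⟨ walks-* grow k (M ^ d) (Ψ d) leaf ⟩
        M ^ d * walks grow k (Ψ d) leaf                     ≤⟨ walks-Ψ d k ⟩
        (B ^ d * (1 + 2 * k) + offset d) * rise 1 k         ≡⟨ walks-of-size k (λ n → B ^ d * n + offset d) ⟨
        walks grow k (λ t → B ^ d * size t + offset d) leaf ∎

-- Separation in a stacked triangulation

-- Multiplicities turn distinctness and disjointness into inequalities between sums, which can be
-- rearranged as ring identities.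
cnt : ℕ → List ℕ → ℕ
cnt u xs = ∑[ x ← xs ] indicator (u ≟ x)

cnt-++ : ∀ u xs ys → cnt u (xs ++ ys) ≡ cnt u xs + cnt u ys
cnt-++ u xs ys = ∑-++ xs ys _

cnt-self : ∀ u → indicator (u ≟ u) ≡ 1
cnt-self u with u ≟ u
... | yes _ = refl
... | no u≢u = ⊥-elim (u≢u refl)

∈⇒cnt : ∀ {u xs} → u ∈ xs → 1 ≤ cnt u xs
∈⇒cnt {u} (here refl) = ≤-trans (≤-reflexive (sym (cnt-self u))) (m≤m+n _ _)
∈⇒cnt (there i) = ≤-trans (∈⇒cnt i) (m≤n+m _ _)

cnt⇒∈ : ∀ {u} xs → 1 ≤ cnt u xs → u ∈ xs
cnt⇒∈ {u} (x ∷ xs) p with u ≟ x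
... | yes e = here e
... | no _ = there (cnt⇒∈ xs p)

sg : ℕ → ℕ
sg zero = 0
sg (suc _) = 1

sg-≤1 : ∀ n → sg n ≤ 1
sg-≤1 zero = z≤n
sg-≤1 (suc n) = ≤-refl

sg-mono : ∀ {m n} → m ≤ n → sg m ≤ sg n
sg-mono {zero} p = z≤n
sg-mono {suc m} (s≤s p) = ≤-refl

sg-pos : ∀ {n} → 1 ≤ n → sg n ≡ 1
sg-pos (s≤s _) = refl

sg-+ : ∀ a b → sg (a + b) ≤ a + sg b
sg-+ zero b = ≤-refl
sg-+ (suc a) b = s≤s z≤n

-- Every step of the path that leaves a block enters the separator C.
module Separation {Adj : ℕ → ℕ → Set} (Bs : List (List ℕ)) (C : List ℕ)
  (disjoint : ∀ u → (∑[ B ← Bs ] cnt u B) ≤ 1)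
  (closed : ∀ u w → Adj u w → All (λ B → u ∈ B → w ∈ B ⊎ w ∈ C) Bs) where

  visited : List ℕ → ℕ
  visited q = ∑[ B ← Bs ] sg (∑[ u ← q ] cnt u B)

  visited-≤ : ∀ u q → Linked Adj (u ∷ q) → visited (u ∷ q) ≤ 1 + (∑[ x ← q ] cnt x C)
  visited-step : ∀ u q → visited (u ∷ q) ≤ 1 + visited q
  visited-step u q = begin
    visited (u ∷ q)                                        ≤⟨ ∑-mono Bs (λ B → sg-+ (cnt u B) _) ⟩
    (∑[ B ← Bs ] cnt u B + sg (∑[ u ← q ] cnt u B))        ≡⟨ ∑-+ Bs _ _ ⟩
    (∑[ B ← Bs ] cnt u B) + visited q                      ≤⟨ +-monoˡ-≤ (visited q) (disjoint u) ⟩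
    1 + visited q                                          ∎
    where open ≤-Reasoning

  visited-≤ u [] [-] = ≤-trans (visited-step u []) (≤-reflexive (cong suc (∑-zero Bs)))
  -- If the next vertex w lies in `C`, it pays for the block of u. Otherwise w lies in the same
  -- block as u, which is therefore counted already.
  visited-≤ u (w ∷ r) (uw ∷ l) with cnt w C in eq
  ... | suc c = ≤-trans (visited-step u (w ∷ r))
    (s≤s (≤-trans (visited-≤ w r l) (s≤s (m≤n+m _ c))))
  ... | zero = ≤-trans (∑-monoAll (All.map (λ {B} → stays B) (closed u w uw))) (visited-≤ w r l)
    where
    stays : ∀ B → (u ∈ B → w ∈ B ⊎ w ∈ C) →
      sg (∑[ x ← u ∷ w ∷ r ] cnt x B) ≤ sg (∑[ x ← w ∷ r ] cnt x B)
    stays B h with cnt u B in e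
    ... | zero = ≤-refl
    ... | suc _ with h (cnt⇒∈ B (≤-trans (s≤s z≤n) (≤-reflexive (sym e))))
    ...   | inj₁ w∈B = ≤-reflexive (sym (sg-pos (≤-trans (∈⇒cnt w∈B) (m≤m+n _ _))))
    ...   | inj₂ w∈C with () ← subst (1 ≤_) eq (∈⇒cnt w∈C)

verts : Tree ℕ → List ℕ
verts leaf = []
verts (node v a b c) = v ∷ verts a ++ (verts b ++ verts c)

shape : Tree ℕ → Shape
shape leaf = leaf
shape (node v a b c) = node′ (shape a) (shape b) (shape c)

size-shape : ∀ t → size (shape t) ≡ size t
size-shape leaf = refl
size-shape (node _ a b c) = cong₂ _+_ (cong₂ _+_ (size-shape a) (size-shape b)) (size-shape c)

over-shape : ∀ f t → over f (shape t) ≡ over (f ∘ shape) t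
over-shape f leaf = refl
over-shape f (node _ a b c) = refl

corners : Face → List ℕ
corners (p , q , r) = p ∷ q ∷ r ∷ []

Star : ℕ → Face → ℕ → ℕ → Set
Star v f u w = (u ≡ v × w ∈ corners f) ⊎ (w ≡ v × u ∈ corners f)

-- Only the edges drawn inside the face: its three sides belong to an ancestor or to the outer
-- triangle. The order of the corners follows `build`.
Edges : Tree ℕ → Face → ℕ → ℕ → Set
Edges leaf _ _ _ = ⊥
Edges (node v a b c) (p , q , r) u w =
  Star v (p , q , r) u w ⊎ Edges a (p , q , v) u w ⊎ Edges b (p , r , v) u w ⊎ Edges c (q , r , v) u w

Edges-sym : ∀ t f {u w} → Edges t f u w → Edges t f w u
Edges-sym (node v a b c) f (inj₁ (inj₁ e)) = inj₁ (inj₂ e)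
Edges-sym (node v a b c) f (inj₁ (inj₂ e)) = inj₁ (inj₁ e)
Edges-sym (node v a b c) f (inj₂ (inj₁ e)) = inj₂ (inj₁ (Edges-sym a _ e))
Edges-sym (node v a b c) f (inj₂ (inj₂ (inj₁ e))) = inj₂ (inj₂ (inj₁ (Edges-sym b _ e)))
Edges-sym (node v a b c) f (inj₂ (inj₂ (inj₂ e))) = inj₂ (inj₂ (inj₂ (Edges-sym c _ e)))

cnt-node : ∀ u v a b c f → cnt u (corners f ++ verts (node v a b c)) ≡
  cnt u (corners f) + (indicator (u ≟ v) + (cnt u (verts a) + (cnt u (verts b) + cnt u (verts c))))
cnt-node u v a b c f
  rewrite cnt-++ u (corners f) (v ∷ verts a ++ (verts b ++ verts c))
        | cnt-++ u (verts a) (verts b ++ verts c) | cnt-++ u (verts b) (verts c) = refl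

-- Inclusion of the closed triangles of the three children in that of the node.
module _ {u v p q r : ℕ} {xs ys : List ℕ} (inc : u ∈ xs → u ∈ ys) where
  in₁ : u ∈ p ∷ q ∷ v ∷ xs → u ∈ p ∷ q ∷ r ∷ v ∷ ys
  in₁ (here e) = here e
  in₁ (there (here e)) = there (here e)
  in₁ (there (there (here e))) = there (there (there (here e)))
  in₁ (there (there (there i))) = there (there (there (there (inc i))))

  in₂ : u ∈ p ∷ r ∷ v ∷ xs → u ∈ p ∷ q ∷ r ∷ v ∷ ys
  in₂ (here e) = here e
  in₂ (there (here e)) = there (there (here e))
  in₂ (there (there (here e))) = there (there (there (here e)))
  in₂ (there (there (there i))) = there (there (there (there (inc i))))

  in₃ : u ∈ q ∷ r ∷ v ∷ xs → u ∈ p ∷ q ∷ r ∷ v ∷ ys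
  in₃ (here e) = there (here e)
  in₃ (there (here e)) = there (there (here e))
  in₃ (there (there (here e))) = there (there (there (here e)))
  in₃ (there (there (there i))) = there (there (there (there (inc i))))

Edges-∈ : ∀ t f {u w} → Edges t f u w → u ∈ corners f ++ verts t
Edges-∈ (node v a b c) f (inj₁ (inj₁ (refl , _))) = there (there (there (here refl)))
Edges-∈ (node v a b c) f (inj₁ (inj₂ (_ , i))) = ∈-++⁺ˡ i
Edges-∈ (node v a b c) f (inj₂ (inj₁ e)) = in₁ ∈-++⁺ˡ (Edges-∈ a _ e)
Edges-∈ (node v a b c) f (inj₂ (inj₂ (inj₁ e))) = in₂ (∈-++⁺ʳ (verts a) ∘ ∈-++⁺ˡ) (Edges-∈ b _ e)
Edges-∈ (node v a b c) f (inj₂ (inj₂ (inj₂ e))) = in₃ (∈-++⁺ʳ (verts a) ∘ ∈-++⁺ʳ (verts b)) (Edges-∈ c _ e)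

Distinct : Tree ℕ → Face → Set
Distinct t f = ∀ u → cnt u (corners f ++ verts t) ≤ 1

-- The local form of planarity: every edge at an inner vertex is drawn inside the triangle, so the
-- corners cut the inside off.
Owns : (ℕ → ℕ → Set) → Tree ℕ → Face → Set
Owns Adj t f = ∀ u w → Adj u w → u ∈ verts t → Edges t f u w

module _ {v p q r : ℕ} {a b c : Tree ℕ} (distinct : Distinct (node v a b c) (p , q , r)) where

  private
    f = p , q , r
    cnt-≤1 : ∀ u → cnt u (corners f) + (indicator (u ≟ v) +
      (cnt u (verts a) + (cnt u (verts b) + cnt u (verts c)))) ≤ 1
    cnt-≤1 u = subst (_≤ 1) (cnt-node u v a b c f) (distinct u)
    clash : ∀ {u xs} ys zs → u ∈ xs → u ∈ corners f ++ (v ∷ ys ++ zs) →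
      cnt u xs + (cnt u (corners f) + (indicator (u ≟ v) + (cnt u ys + cnt u zs))) ≤ 1 → ⊥
    clash {u} ys zs i j b = 1+n≰n (≤-trans (+-mono-≤ (∈⇒cnt i)
      (≤-trans (∈⇒cnt j) (≤-reflexive (trans (cnt-++ u (corners f) (v ∷ ys ++ zs))
        (cong (λ z → cnt u (corners f) + (indicator (u ≟ v) + z)) (cnt-++ u ys zs)))))) b)
    drop : ∀ {x y z} → x + y ≡ z → z ≤ 1 → x ≤ 1
    drop {x} {y} refl = m+n≤o⇒m≤o x

  Distinct₁ : Distinct a (p , q , v)
  Distinct₁ u = drop (e (indicator (u ≟ p)) (indicator (u ≟ q)) (indicator (u ≟ r)) (indicator (u ≟ v))
      (cnt u (verts a)) (cnt u (verts b) + cnt u (verts c))) (cnt-≤1 u)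
    where
    e : ∀ p q r v a b → p + (q + (v + a)) + (r + b) ≡ p + (q + (r + 0)) + (v + (a + b))
    e = solve-∀

  Distinct₂ : Distinct b (p , r , v)
  Distinct₂ u = drop (e (indicator (u ≟ p)) (indicator (u ≟ q)) (indicator (u ≟ r)) (indicator (u ≟ v))
      (cnt u (verts a)) (cnt u (verts b)) (cnt u (verts c))) (cnt-≤1 u)
    where
    e : ∀ p q r v a b c → p + (r + (v + b)) + (q + (a + c)) ≡ p + (q + (r + 0)) + (v + (a + (b + c)))
    e = solve-∀

  Distinct₃ : Distinct c (q , r , v)
  Distinct₃ u = drop (e (indicator (u ≟ p)) (indicator (u ≟ q)) (indicator (u ≟ r)) (indicator (u ≟ v))
      (cnt u (verts a)) (cnt u (verts b)) (cnt u (verts c))) (cnt-≤1 u)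
    where
    e : ∀ p q r v a b c → q + (r + (v + c)) + (p + (a + b)) ≡ p + (q + (r + 0)) + (v + (a + (b + c)))
    e = solve-∀

  module _ {Adj : ℕ → ℕ → Set} (owns : Owns Adj (node v a b c) f) where

    -- An edge at an inner vertex u of `a` that was drawn in another part would, by `Edges-∈`, make
    -- u a second time a vertex of the closed triangle.
    Owns₁ : Owns Adj a (p , q , v)
    Owns₁ u w uw i = go (owns u w uw (there (∈-++⁺ˡ i)))
      where
      never : u ∈ corners f ++ (v ∷ verts b ++ verts c) → Edges a (p , q , v) u w
      never j = ⊥-elim (clash (verts b) (verts c) i j
        (subst (_≤ 1) (e (cnt u (corners f)) (indicator (u ≟ v)) (cnt u (verts a)) (cnt u (verts b)) (cnt u (verts c))) (cnt-≤1 u)))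
        where
        e : ∀ f v a b c → f + (v + (a + (b + c))) ≡ a + (f + (v + (b + c)))
        e = solve-∀
      go : Edges (node v a b c) f u w → Edges a (p , q , v) u w
      go (inj₁ (inj₁ (refl , _))) = never (there (there (there (here refl))))
      go (inj₁ (inj₂ (_ , j))) = never (∈-++⁺ˡ j)
      go (inj₂ (inj₁ e)) = e
      go (inj₂ (inj₂ (inj₁ e))) = never (in₂ ∈-++⁺ˡ (Edges-∈ b _ e))
      go (inj₂ (inj₂ (inj₂ e))) = never (in₃ (∈-++⁺ʳ (verts b)) (Edges-∈ c _ e))

    Owns₂ : Owns Adj b (p , r , v)
    Owns₂ u w uw i = go (owns u w uw (there (∈-++⁺ʳ (verts a) (∈-++⁺ˡ i))))
      where
      never : u ∈ corners f ++ (v ∷ verts a ++ verts c) → Edges b (p , r , v) u w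
      never j = ⊥-elim (clash (verts a) (verts c) i j
        (subst (_≤ 1) (e (cnt u (corners f)) (indicator (u ≟ v)) (cnt u (verts a)) (cnt u (verts b)) (cnt u (verts c))) (cnt-≤1 u)))
        where
        e : ∀ f v a b c → f + (v + (a + (b + c))) ≡ b + (f + (v + (a + c)))
        e = solve-∀
      go : Edges (node v a b c) f u w → Edges b (p , r , v) u w
      go (inj₁ (inj₁ (refl , _))) = never (there (there (there (here refl))))
      go (inj₁ (inj₂ (_ , j))) = never (∈-++⁺ˡ j)
      go (inj₂ (inj₁ e)) = never (in₁ ∈-++⁺ˡ (Edges-∈ a _ e))
      go (inj₂ (inj₂ (inj₁ e))) = e
      go (inj₂ (inj₂ (inj₂ e))) = never (in₃ (∈-++⁺ʳ (verts a)) (Edges-∈ c _ e))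

    Owns₃ : Owns Adj c (q , r , v)
    Owns₃ u w uw i = go (owns u w uw (there (∈-++⁺ʳ (verts a) (∈-++⁺ʳ (verts b) i))))
      where
      never : u ∈ corners f ++ (v ∷ verts a ++ verts b) → Edges c (q , r , v) u w
      never j = ⊥-elim (clash (verts a) (verts b) i j
        (subst (_≤ 1) (e (cnt u (corners f)) (indicator (u ≟ v)) (cnt u (verts a)) (cnt u (verts b)) (cnt u (verts c))) (cnt-≤1 u)))
        where
        e : ∀ f v a b c → f + (v + (a + (b + c))) ≡ c + (f + (v + (a + b)))
        e = solve-∀
      go : Edges (node v a b c) f u w → Edges c (q , r , v) u w
      go (inj₁ (inj₁ (refl , _))) = never (there (there (there (here refl))))
      go (inj₁ (inj₂ (_ , j))) = never (∈-++⁺ˡ j)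
      go (inj₂ (inj₁ e)) = never (in₁ ∈-++⁺ˡ (Edges-∈ a _ e))
      go (inj₂ (inj₂ (inj₁ e))) = never (in₂ (∈-++⁺ʳ (verts a)) (Edges-∈ b _ e))
      go (inj₂ (inj₂ (inj₂ e))) = e

-- Faces reached by a path

square-cancel-≤ : ∀ {m n} → m * m ≤ n * n → m ≤ n
square-cancel-≤ {m} {n} p with m ≤? n
... | yes m≤n = m≤n
... | no m≰n = ⊥-elim (<⇒≱ (*-mono-< (≰⇒> m≰n) (≰⇒> m≰n)) p)

-- Without square roots, the cross term is compared after squaring: (2 K a b)² ≤ 4 (g t) (h s) ≤ (g
-- t + h s)².
cauchy : ∀ K a b g h s t → K * (a * a) ≤ g * s → K * (b * b) ≤ h * t →
  K * ((a + b) * (a + b)) ≤ (g + h) * (s + t)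
cauchy K a b g h s t p q = begin
  K * ((a + b) * (a + b))
    ≡⟨ r₁ K a b ⟩
  K * (a * a) + K * (b * b) + 2 * (K * (a * b))
    ≤⟨ +-mono-≤ (+-mono-≤ p q) (square-cancel-≤ (begin
        2 * (K * (a * b)) * (2 * (K * (a * b)))   ≡⟨ r₃ K a b ⟩
        4 * (K * (a * a) * (K * (b * b)))         ≤⟨ *-monoʳ-≤ 4 (*-mono-≤ p q) ⟩
        4 * (g * s * (h * t))                     ≡⟨ r₄ g s h t ⟩
        4 * (g * t * (h * s))                     ≤⟨ am-gm (g * t) (h * s) ⟩
        (g * t + h * s) * (g * t + h * s)         ∎)) ⟩
  g * s + h * t + (g * t + h * s)
    ≡⟨ r₂ g h s t ⟩
  (g + h) * (s + t) ∎
  where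
  open ≤-Reasoning
  am-gm : ∀ x y → 4 * (x * y) ≤ (x + y) * (x + y)
  am-gm x y = [ (λ x≤y → ordered x≤y) , (λ y≤x → subst₂ _≤_ (cong (4 *_) (*-comm y x))
      (cong (λ z → z * z) (+-comm y x)) (ordered y≤x)) ]′ (≤-total x y)
    where
    square : ∀ x d → (x + (x + d)) * (x + (x + d)) ≡ 4 * (x * (x + d)) + d * d
    square = solve-∀
    ordered : ∀ {x y} → x ≤ y → 4 * (x * y) ≤ (x + y) * (x + y)
    ordered {x} {y} x≤y rewrite sym (m+[n∸m]≡n x≤y) =
      m+n≤o⇒m≤o _ (≤-reflexive (sym (square x (y ∸ x))))
  r₁ : ∀ k a b → k * ((a + b) * (a + b)) ≡ k * (a * a) + k * (b * b) + 2 * (k * (a * b))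
  r₁ = solve-∀
  r₂ : ∀ g h s t → g * s + h * t + (g * t + h * s) ≡ (g + h) * (s + t)
  r₂ = solve-∀
  r₃ : ∀ k a b → 2 * (k * (a * b)) * (2 * (k * (a * b))) ≡ 4 * (k * (a * a) * (k * (b * b)))
  r₃ = solve-∀
  r₄ : ∀ g s h t → 4 * (g * s * (h * t)) ≡ 4 * (g * t * (h * s))
  r₄ = solve-∀

-- Each entry with v = 0 loses s, which is at least N / M; terms are moved across to avoid
-- subtraction.
lost-share : ∀ M N (xs : List (ℕ × ℕ)) → All (λ (v , s) → v ≤ 1 × N ≤ M * s) xs →
  M * (∑[ x ← xs ] proj₁ x * proj₂ x) + length xs * N ≤
  M * (∑[ x ← xs ] proj₂ x) + (∑[ x ← xs ] proj₁ x) * N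
lost-share M N [] [] = ≤-refl
lost-share M N ((v , s) ∷ xs) ((v≤1 , N≤Ms) ∷ ps) = begin
  M * (v * s + P) + (1 + l) * N        ≡⟨ r₁ M v s P l N ⟩
  M * (v * s) + N + (M * P + l * N)    ≤⟨ +-mono-≤ (item v≤1) (lost-share M N xs ps) ⟩
  M * s + v * N + (M * S + V * N)      ≡⟨ r₂ M s v N S V ⟩
  M * (s + S) + (v + V) * N            ∎
  where
  open ≤-Reasoning
  P = ∑[ x ← xs ] proj₁ x * proj₂ x
  S = ∑[ x ← xs ] proj₂ x
  V = ∑[ x ← xs ] proj₁ x
  l = length xs
  item : ∀ {v} → v ≤ 1 → M * (v * s) + N ≤ M * s + v * N
  item z≤n = ≤-trans (≤-reflexive (cong (_+ N) (*-zeroʳ M))) (≤-trans N≤Ms (m≤m+n _ 0))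
  item (s≤s z≤n) = ≤-reflexive (cong₂ _+_ (cong (M *_) (*-identityˡ s)) (sym (*-identityˡ N)))
  r₁ : ∀ m v s x l n → m * (v * s + x) + (1 + l) * n ≡ m * (v * s) + n + (m * x + l * n)
  r₁ = solve-∀
  r₂ : ∀ m s v n t w → m * s + v * n + (m * t + w * n) ≡ m * (s + t) + (v + w) * n
  r₂ = solve-∀

over-+const : ∀ (f : Tree L → ℕ) c t → over (λ t → f t + c) t ≤ over f t + 3 * c
over-+const f c leaf = +-monoʳ-≤ (f leaf) (m≤m+n c _)
over-+const f c (node _ x y z) = ≤-reflexive (collect (f x) (f y) (f z) c)
  where
  collect : ∀ x y z c → x + c + (y + c) + (z + c) ≡ x + y + z + 3 * c
  collect = solve-∀

-- Vertices that sit above depth 2 d: a node and its three children make 4, then the nine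
-- grandchildren follow.
slack : ℕ → ℕ
slack zero = 0
slack (suc d) = 4 + 9 * slack d

module OnPath {Adj : ℕ → ℕ → Set} (p : List ℕ) (linked : Linked Adj p)
  (simple : ∀ v → (∑[ u ← p ] indicator (u ≟ v)) ≤ 1) where

  load : List ℕ → ℕ
  load xs = ∑[ u ← p ] cnt u xs

  load-++ : ∀ xs ys → load (xs ++ ys) ≡ load xs + load ys
  load-++ xs ys = trans (∑-cong p (λ u → cnt-++ u xs ys)) (∑-+ p _ _)

  load-∷ : ∀ v xs → load (v ∷ xs) ≤ 1 + load xs
  load-∷ v xs = ≤-trans (≤-reflexive (∑-+ p (λ u → indicator (u ≟ v)) (λ u → cnt u xs)))
                        (+-monoˡ-≤ (load xs) (simple v))

  load-[] : load [] ≡ 0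
  load-[] = ∑-zero p

  load-≤ : ∀ xs → load xs ≤ length xs
  load-≤ [] = ≤-reflexive load-[]
  load-≤ (v ∷ xs) = ≤-trans (load-∷ v xs) (s≤s (load-≤ xs))

  loadᵗ : Tree ℕ → ℕ
  loadᵗ t = load (verts t)

  loadᵗ-node : ∀ v a b c → loadᵗ (node v a b c) ≤ 1 + (loadᵗ a + loadᵗ b + loadᵗ c)
  loadᵗ-node v a b c = ≤-trans (load-∷ v (verts a ++ (verts b ++ verts c))) (s≤s (≤-reflexive
    (trans (load-++ (verts a) (verts b ++ verts c)) (trans (cong (loadᵗ a +_) (load-++ (verts b) (verts c))) (sym (+-assoc (loadᵗ a) _ _))))))

  kids-≤ : ∀ v a b c → loadᵗ a + loadᵗ b + loadᵗ c ≤ loadᵗ (node v a b c)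
  kids-≤ v a b c = ≤-trans (≤-reflexive (trans (+-assoc (loadᵗ a) _ _)
      (sym (trans (load-++ (verts a) (verts b ++ verts c)) (cong (loadᵗ a +_) (load-++ (verts b) (verts c)))))))
    (∑-mono p (λ u → m≤n+m (cnt u (verts a ++ (verts b ++ verts c))) (indicator (u ≟ v))))

  loadᵗ-≤-over : ∀ t → loadᵗ t ≤ over loadᵗ t + 1
  loadᵗ-≤-over leaf = m≤m+n _ 1
  loadᵗ-≤-over (node v a b c) = ≤-trans (loadᵗ-node v a b c) (≤-reflexive (+-comm 1 _))

  -- A triangle with n inner vertices has 2 n + 1 faces, and a simple path meets each inner vertex
  -- at most once.
  loadᵗ-≤-size : ∀ t → 1 + 2 * loadᵗ t ≤ size t
  loadᵗ-≤-size leaf = ≤-reflexive (cong (λ z → 1 + 2 * z) load-[])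
  loadᵗ-≤-size (node v a b c) = begin
    1 + 2 * loadᵗ (node v a b c)                                     ≤⟨ s≤s (*-monoʳ-≤ 2 (loadᵗ-node v a b c)) ⟩
    1 + 2 * (1 + (loadᵗ a + loadᵗ b + loadᵗ c))                      ≡⟨ collect (loadᵗ a) (loadᵗ b) (loadᵗ c) ⟩
    1 + 2 * loadᵗ a + (1 + 2 * loadᵗ b) + (1 + 2 * loadᵗ c)
      ≤⟨ +-mono-≤ (+-mono-≤ (loadᵗ-≤-size a) (loadᵗ-≤-size b)) (loadᵗ-≤-size c) ⟩
    size a + size b + size c                                         ∎
    where
    open ≤-Reasoning
    collect : ∀ a b c → 1 + 2 * (1 + (a + b + c)) ≡ 1 + 2 * a + (1 + 2 * b) + (1 + 2 * c)
    collect = solve-∀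

  visit : Tree ℕ → ℕ
  visit t = sg (loadᵗ t)

  -- A subtree at depth 2 d counts with all its faces as soon as one of its inner vertices is on the
  -- path.
  reach : ℕ → Tree ℕ → ℕ
  reach zero t = visit t * size t
  reach (suc d) = over^ 2 (reach d)

  reach₀-over : ∀ t → over (reach 0) t ≤ reach 0 t
  reach₀-over leaf = ≤-refl
  reach₀-over t@(node v a b c) = begin
    visit a * size a + visit b * size b + visit c * size c
      ≤⟨ +-mono-≤ (+-mono-≤ (*-monoˡ-≤ (size a) (below {loadᵗ a} (≤-trans (m≤m+n _ _) (m≤m+n _ _))))
                            (*-monoˡ-≤ (size b) (below {loadᵗ b} (≤-trans (m≤n+m _ (loadᵗ a)) (m≤m+n _ _)))))
                  (*-monoˡ-≤ (size c) (below {loadᵗ c} (m≤n+m _ (loadᵗ a + loadᵗ b)))) ⟩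
    visit t * size a + visit t * size b + visit t * size c
      ≡⟨ collect (visit t) (size a) (size b) (size c) ⟩
    visit t * (size a + size b + size c) ∎
    where
    open ≤-Reasoning
    below : ∀ {n} → n ≤ loadᵗ a + loadᵗ b + loadᵗ c → sg n ≤ visit t
    below q = sg-mono (≤-trans q (kids-≤ v a b c))
    collect : ∀ v a b c → v * a + v * b + v * c ≡ v * (a + b + c)
    collect = solve-∀

  loadᵗ-≤-reach : ∀ d t → loadᵗ t ≤ reach d t + slack d
  loadᵗ-≤-reach zero t with loadᵗ t | loadᵗ-≤-size t
  ... | zero | _ = z≤n
  ... | suc l | q = ≤-trans (≤-trans (n≤1+n _) (≤-trans (s≤s (m≤m+n _ _)) q))
    (≤-reflexive (trans (sym (*-identityˡ (size t))) (sym (+-identityʳ _))))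
  loadᵗ-≤-reach (suc d) t = begin
    loadᵗ t
      ≤⟨ loadᵗ-≤-over t ⟩
    over loadᵗ t + 1
      ≤⟨ +-monoˡ-≤ 1 (over-mono loadᵗ-≤-over t) ⟩
    over (λ t → over loadᵗ t + 1) t + 1
      ≤⟨ +-monoˡ-≤ 1 (over-+const (over loadᵗ) 1 t) ⟩
    over^ 2 loadᵗ t + 3 + 1
      ≤⟨ +-monoˡ-≤ 1 (+-monoˡ-≤ 3 (over-mono (over-mono (loadᵗ-≤-reach d)) t)) ⟩
    over^ 2 (λ t → reach d t + slack d) t + 3 + 1
      ≤⟨ +-monoˡ-≤ 1 (+-monoˡ-≤ 3 (over-mono (over-+const (reach d) (slack d)) t)) ⟩
    over (λ t → over (reach d) t + 3 * slack d) t + 3 + 1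
      ≤⟨ +-monoˡ-≤ 1 (+-monoˡ-≤ 3 (over-+const (over (reach d)) (3 * slack d) t)) ⟩
    reach (suc d) t + 3 * (3 * slack d) + 3 + 1
      ≡⟨ collect (reach (suc d) t) (slack d) ⟩
    reach (suc d) t + slack (suc d) ∎
    where
    open ≤-Reasoning
    collect : ∀ r s → r + 3 * (3 * s) + 3 + 1 ≡ r + (4 + 9 * s)
    collect = solve-∀

  record Good (t : Tree ℕ) (f : Face) : Set where
    constructor good
    field
      distinct : Distinct t f
      owns : Owns Adj t f
  open Good

  module _ {v p q r : ℕ} {a b c : Tree ℕ} (G : Good (node v a b c) (p , q , r)) where
    Good₁ : Good a (p , q , v)
    Good₁ = good (Distinct₁ {v} {p} {q} {r} {a} {b} {c} (distinct G)) (Owns₁ (distinct G) (owns G))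
    Good₂ : Good b (p , r , v)
    Good₂ = good (Distinct₂ {v} {p} {q} {r} {a} {b} {c} (distinct G)) (Owns₂ (distinct G) (owns G))
    Good₃ : Good c (q , r , v)
    Good₃ = good (Distinct₃ {v} {p} {q} {r} {a} {b} {c} (distinct G)) (Owns₃ (distinct G) (owns G))

  cauchy-over : ∀ K {f g h : Tree ℕ → ℕ} → (∀ t c → Good t c → K * (f t * f t) ≤ g t * h t) →
    ∀ t c → Good t c → K * (over f t * over f t) ≤ over g t * over h t
  cauchy-over K q leaf c G = q leaf c G
  cauchy-over K {f} {g} {h} q (node v x y z) c G =
    cauchy K (f x + f y) (f z) (g x + g y) (g z) (h x + h y) (h z) (cauchy K (f x) (f y) (g x) (g y) (h x) (h y) (q x _ (Good₁ G)) (q y _ (Good₂ G))) (q z _ (Good₃ G))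

  -- Seven vertices separate the nine grandchildren.
  visit-≤8 : ∀ {v v₁ v₂ v₃ a₁ a₂ a₃ b₁ b₂ b₃ c₁ c₂ c₃ f} →
    Good (node v (node v₁ a₁ a₂ a₃) (node v₂ b₁ b₂ b₃) (node v₃ c₁ c₂ c₃)) f →
    (∑[ t ← a₁ ∷ a₂ ∷ a₃ ∷ b₁ ∷ b₂ ∷ b₃ ∷ c₁ ∷ c₂ ∷ c₃ ∷ [] ] visit t) ≤ 8
  visit-≤8 {v} {v₁} {v₂} {v₃} {a₁} {a₂} {a₃} {b₁} {b₂} {b₃} {c₁} {c₂} {c₃} {p₁ , p₂ , p₃} G =
    go p linked refl
    where
    ts : List (Tree ℕ)
    ts = a₁ ∷ a₂ ∷ a₃ ∷ b₁ ∷ b₂ ∷ b₃ ∷ c₁ ∷ c₂ ∷ c₃ ∷ []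
    C : List ℕ
    C = p₁ ∷ p₂ ∷ p₃ ∷ v ∷ v₁ ∷ v₂ ∷ v₃ ∷ []
    i₁ : p₁ ∈ C
    i₁ = here refl
    i₂ : p₂ ∈ C
    i₂ = there (here refl)
    i₃ : p₃ ∈ C
    i₃ = there (there (here refl))
    j₀ : v ∈ C
    j₀ = there (there (there (here refl)))
    j₁ : v₁ ∈ C
    j₁ = there (there (there (there (here refl))))
    j₂ : v₂ ∈ C
    j₂ = there (there (there (there (there (here refl)))))
    j₃ : v₃ ∈ C
    j₃ = there (there (there (there (there (there (here refl))))))
    disjoint : ∀ u → (∑[ B ← map verts ts ] cnt u B) ≤ 1
    disjoint u = ≤-trans (≤-trans
        (m+n≤o⇒m≤o _ (≤-reflexive (sym regrouped)))
        (m≤n+m _ (cnt u (corners (p₁ , p₂ , p₃)))))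
      (≤-trans (≤-reflexive (sym (cnt-node u v (node v₁ a₁ a₂ a₃) (node v₂ b₁ b₂ b₃) (node v₃ c₁ c₂ c₃) (p₁ , p₂ , p₃)))) (distinct G u))
      where
      n = cnt u
      inner : ∀ v a b c → cnt u (verts (node v a b c)) ≡
        indicator (u ≟ v) + (n (verts a) + (n (verts b) + n (verts c)))
      inner v a b c = cong (indicator (u ≟ v) +_)
        (trans (cnt-++ u (verts a) _) (cong (n (verts a) +_) (cnt-++ u (verts b) (verts c))))
      regrouped : indicator (u ≟ v) + (n (verts (node v₁ a₁ a₂ a₃)) +
          (n (verts (node v₂ b₁ b₂ b₃)) + n (verts (node v₃ c₁ c₂ c₃)))) ≡
        (∑[ B ← map verts ts ] n B) + (indicator (u ≟ v) + (indicator (u ≟ v₁) + (indicator (u ≟ v₂) + indicator (u ≟ v₃))))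
      regrouped rewrite inner v₁ a₁ a₂ a₃ | inner v₂ b₁ b₂ b₃ | inner v₃ c₁ c₂ c₃ =
        collect (indicator (u ≟ v)) (indicator (u ≟ v₁)) (indicator (u ≟ v₂)) (indicator (u ≟ v₃))
          (n (verts a₁)) (n (verts a₂)) (n (verts a₃)) (n (verts b₁)) (n (verts b₂)) (n (verts b₃))
          (n (verts c₁)) (n (verts c₂)) (n (verts c₃))
        where
        collect : ∀ w w₁ w₂ w₃ a b c d e f g h i →
          w + (w₁ + (a + (b + c)) + (w₂ + (d + (e + f)) + (w₃ + (g + (h + i))))) ≡
          a + (b + (c + (d + (e + (f + (g + (h + (i + 0)))))))) + (w + (w₁ + (w₂ + w₃)))
        collect = solve-∀
    -- An edge that leaves the inside of a grandchild ends at one of its corners, and these all lie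
    -- in `C`.
    closedAt : ∀ {q₁ q₂ q₃} t → Good t (q₁ , q₂ , q₃) → q₁ ∈ C → q₂ ∈ C → q₃ ∈ C →
      ∀ {u w} → Adj u w → u ∈ verts t → w ∈ verts t ⊎ w ∈ C
    closedAt t g k₁ k₂ k₃ {u} {w} uw i with Edges-∈ t _ (Edges-sym t _ (owns g u w uw i))
    ... | here refl = inj₂ k₁
    ... | there (here refl) = inj₂ k₂
    ... | there (there (here refl)) = inj₂ k₃
    ... | there (there (there k)) = inj₁ k
    closed : ∀ u w → Adj u w → All (λ B → u ∈ B → w ∈ B ⊎ w ∈ C) (map verts ts)
    closed u w uw =
      closedAt a₁ (Good₁ (Good₁ G)) i₁ i₂ j₁ uw ∷ closedAt a₂ (Good₂ (Good₁ G)) i₁ j₀ j₁ uw ∷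
      closedAt a₃ (Good₃ (Good₁ G)) i₂ j₀ j₁ uw ∷
      closedAt b₁ (Good₁ (Good₂ G)) i₁ i₃ j₂ uw ∷ closedAt b₂ (Good₂ (Good₂ G)) i₁ j₀ j₂ uw ∷
      closedAt b₃ (Good₃ (Good₂ G)) i₃ j₀ j₂ uw ∷
      closedAt c₁ (Good₁ (Good₃ G)) i₂ i₃ j₃ uw ∷ closedAt c₂ (Good₂ (Good₃ G)) i₂ j₀ j₃ uw ∷
      closedAt c₃ (Good₃ (Good₃ G)) i₃ j₀ j₃ uw ∷ []
    open Separation (map verts ts) C disjoint closed
    -- 8 = 1 + 7: the first region is free, each further one costs a vertex of `C`, and the path
    -- meets each of these seven at most once.
    go : ∀ q → Linked Adj q → q ≡ p → (∑[ t ← ts ] visit t) ≤ 8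
    go [] _ refl = z≤n
    go (u ∷ q) l refl = ≤-trans (visited-≤ u q l) (s≤s (≤-trans
      (m≤n+m (∑[ x ← q ] cnt x C) (cnt u C)) (load-≤ C)))

  module _ (m : ℕ) where
    open Potential m

    private
      indicator⁻¹ : ∀ {P : Set} (d : Dec P) → indicator d ≡ 1 → P
      indicator⁻¹ (yes p) _ = p

    -- One of nine grandchildren is missed and holds at least N / M faces. This helps only if the
    -- triangle is visited; if it is not, both sides vanish.
    reach₀-lost : ∀ t f → Good t f → bal (shape t) ≡ 1 → M * over^ 2 (reach 0) t ≤ m * reach 0 t
    reach₀-lost t@(node v x@(node v₁ a₁ a₂ a₃) y@(node v₂ b₁ b₂ b₃) z@(node v₃ c₁ c₂ c₃)) f G e =
      by-load (loadᵗ t) refl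
      where
      open ≤-Reasoning
      N = size (shape t)
      β : ℕ → Shape → ℕ
      β = balanced M N
      βx : β 1 (shape x) ≡ 1
      βx = m*n≡1⇒m≡1 _ _ (m*n≡1⇒m≡1 (β 1 (shape x) * β 1 (shape y)) _ e)
      βy : β 1 (shape y) ≡ 1
      βy = m*n≡1⇒n≡1 (β 1 (shape x)) _ (m*n≡1⇒m≡1 (β 1 (shape x) * β 1 (shape y)) _ e)
      βz : β 1 (shape z) ≡ 1
      βz = m*n≡1⇒n≡1 (β 1 (shape x) * β 1 (shape y)) _ e
      share : ∀ t → β 0 (shape t) ≡ 1 → visit t ≤ 1 × N ≤ M * size t
      share t e = sg-≤1 (loadᵗ t) ,
        subst (λ s → N ≤ M * s) (size-shape t) (indicator⁻¹ (N ≤? M * size (shape t)) e)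
      item : Tree ℕ → ℕ × ℕ
      item t = visit t , size t
      ts : List (Tree ℕ)
      ts = a₁ ∷ a₂ ∷ a₃ ∷ b₁ ∷ b₂ ∷ b₃ ∷ c₁ ∷ c₂ ∷ c₃ ∷ []
      shares : ∀ a b c → β 1 (node′ (shape a) (shape b) (shape c)) ≡ 1 →
        ∀ {xs} → All (λ (v , s) → v ≤ 1 × N ≤ M * s) xs →
        All (λ (v , s) → v ≤ 1 × N ≤ M * s) (item a ∷ item b ∷ item c ∷ xs)
      shares a b c e ps =
        share a (m*n≡1⇒m≡1 _ _ (m*n≡1⇒m≡1 (β 0 (shape a) * β 0 (shape b)) _ e)) ∷
        share b (m*n≡1⇒n≡1 (β 0 (shape a)) _ (m*n≡1⇒m≡1 (β 0 (shape a) * β 0 (shape b)) _ e)) ∷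
        share c (m*n≡1⇒n≡1 (β 0 (shape a) * β 0 (shape b)) _ e) ∷ ps
      S = over^ 2 (reach 0) t
      nine : ∀ (g : Tree ℕ → ℕ) → over^ 2 g t ≡ ∑ ts g
      nine g = regroup (g a₁) (g a₂) (g a₃) (g b₁) (g b₂) (g b₃) (g c₁) (g c₂) (g c₃)
        where
        regroup : ∀ a b c d e f g h i → a + b + c + (d + e + f) + (g + h + i) ≡
          a + (b + (c + (d + (e + (f + (g + (h + (i + 0))))))))
        regroup = solve-∀
      sizes : (∑[ x ← map item ts ] proj₂ x) ≡ N
      sizes = trans (sym (nine size)) (sym (size-shape t))
      lost : M * S + N ≤ M * N
      lost = +-cancelʳ-≤ (8 * N) _ _ (begin
        M * S + N + 8 * N
          ≡⟨ +-assoc (M * S) N (8 * N) ⟩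
        M * S + 9 * N
          ≡⟨ cong (λ z → M * z + 9 * N) (nine (reach 0)) ⟩
        M * (∑[ x ← map item ts ] proj₁ x * proj₂ x) + 9 * N
          ≤⟨ lost-share M N (map item ts) (shares a₁ a₂ a₃ βx (shares b₁ b₂ b₃ βy (shares c₁ c₂ c₃ βz []))) ⟩
        M * (∑[ x ← map item ts ] proj₂ x) + (∑[ t ← ts ] visit t) * N
          ≤⟨ +-mono-≤ (≤-reflexive (cong (M *_) sizes)) (*-monoˡ-≤ N (visit-≤8 G)) ⟩
        M * N + 8 * N ∎)
      by-load : ∀ l → loadᵗ t ≡ l → M * S ≤ m * reach 0 t
      by-load zero e = ≤-trans (*-monoʳ-≤ M (≤-trans (over-mono reach₀-over t) (reach₀-over t)))
        (≤-reflexive (trans (cong (M *_) r≡0) (trans (*-zeroʳ M) (sym (trans (cong (m *_) r≡0) (*-zeroʳ m))))))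
        where
        r≡0 : reach 0 t ≡ 0
        r≡0 = cong (λ l → sg l * size t) e
      by-load (suc l) e = +-cancelʳ-≤ N _ _ (≤-trans lost (≤-reflexive (trans (+-comm N (m * N))
        (cong (λ z → m * z + N) (trans (size-shape t) (sym r≡N))))))
        where
        r≡N : reach 0 t ≡ size t
        r≡N = trans (cong (λ l → sg l * size t) e) (*-identityˡ (size t))
    -- A leaf among the children puts a factor 0 into `bal`.
    reach₀-lost t@(node _ x@(node _ _ _ _) y@(node _ _ _ _) leaf) _ _ e
      with () ← m*n≡1⇒n≡1 (balanced M (size (shape t)) 1 (shape x) * balanced M (size (shape t)) 1 (shape y)) 0 e
    reach₀-lost t@(node _ x@(node _ _ _ _) leaf z) _ _ e
      with () ← m*n≡1⇒n≡1 (balanced M (size (shape t)) 1 (shape x)) 0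
        (m*n≡1⇒m≡1 _ (balanced M (size (shape t)) 1 (shape z)) e)

    reach₀-shrinks : ∀ t f → Good t f → M * over^ 2 (reach 0) t ≤ weight (shape t) * reach 0 t
    reach₀-shrinks t f G with bal (shape t) in e | balanced-01 M (size (shape t)) 2 (shape t)
    ... | _ | inj₁ refl = *-mono-≤ (≤-reflexive (+-comm 1 m)) (≤-trans (over-mono reach₀-over t) (reach₀-over t))
    ... | _ | inj₂ refl = ≤-trans (reach₀-lost t f G e) (*-monoˡ-≤ (reach 0 t) (m≤m+n m 0))

    reach-≤ : ∀ d t f → Good t f → M ^ d * (reach d t * reach d t) ≤ reach 0 t * Ψ d (shape t)
    reach-≤ zero t f G = begin
      1 * (reach 0 t * reach 0 t)      ≡⟨ *-identityˡ _ ⟩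
      reach 0 t * reach 0 t            ≤⟨ *-monoʳ-≤ (reach 0 t) (*-monoˡ-≤ (size t) (sg-≤1 (loadᵗ t))) ⟩
      reach 0 t * (1 * size t)         ≡⟨ cong (reach 0 t *_) (trans (*-identityˡ _) (sym (size-shape t))) ⟩
      reach 0 t * size (shape t)       ∎
      where open ≤-Reasoning
    reach-≤ (suc d) t f G = begin
      M * M ^ d * (r * r)              ≡⟨ *-assoc M (M ^ d) _ ⟩
      M * (M ^ d * (r * r))            ≤⟨ *-monoʳ-≤ M (cauchy-over (M ^ d) (cauchy-over (M ^ d) (reach-≤ d)) t f G) ⟩
      M * (over^ 2 (reach 0) t * ψ)    ≡⟨ *-assoc M (over^ 2 (reach 0) t) ψ ⟨
      -- The spare factor M is spent here: the sum of `reach 0` over the grandchildren collapses to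
      -- `reach 0 t` at the price of the weight.
      M * over^ 2 (reach 0) t * ψ      ≤⟨ *-monoˡ-≤ ψ (reach₀-shrinks t f G) ⟩
      w * reach 0 t * ψ                ≡⟨ rearrange w (reach 0 t) ψ ⟩
      reach 0 t * (w * ψ)              ≡⟨ cong (λ z → reach 0 t * (w * z)) (over²-shape t) ⟩
      reach 0 t * Ψ (suc d) (shape t)  ∎
      where
      open ≤-Reasoning
      r = reach (suc d) t
      w = weight (shape t)
      ψ = over^ 2 (Ψ d ∘ shape) t
      rearrange : ∀ a b c → a * b * c ≡ b * (a * c)
      rearrange = solve-∀
      over²-shape : ∀ t → over^ 2 (Ψ d ∘ shape) t ≡ over^ 2 (Ψ d) (shape t)
      over²-shape leaf = refl
      over²-shape (node _ a b c) =
        sym (cong₂ _+_ (cong₂ _+_ (over-shape (Ψ d) a) (over-shape (Ψ d) b)) (over-shape (Ψ d) c))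

-- The tree of a history

data Child : Set where
  first second third : Child

Address : Set
Address = List Child

growAt : Tree ℕ → Address → ℕ → Tree ℕ
-- Default values: a leaf accepts any remaining address, and an address that ends at a node changes
-- nothing.
growAt leaf _ w = node w leaf leaf leaf
growAt (node v a b c) [] w = node v a b c
growAt (node v a b c) (first ∷ α) w = node v (growAt a α w) b c
growAt (node v a b c) (second ∷ α) w = node v a (growAt b α w) c
growAt (node v a b c) (third ∷ α) w = node v a b (growAt c α w)

under : Child → Address × Face → Address × Face
under x (α , f) = x ∷ α , f

leaves : Tree ℕ → Face → List (Address × Face)
leaves leaf f = ([] , f) ∷ []
leaves (node v a b c) (p , q , r) =
  map (under first) (leaves a (p , q , v)) ++
  (map (under second) (leaves b (p , r , v)) ++ map (under third) (leaves c (q , r , v)))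

split : Address × Face → ℕ → List (Address × Face)
split (α , p , q , r) v =
  (α ∷ʳ first , p , q , v) ∷ (α ∷ʳ second , p , r , v) ∷ (α ∷ʳ third , q , r , v) ∷ []

-- Allows induction along the address, which membership in `leaves` hides behind appended lists.
data LeafAt : Tree ℕ → Face → Address → Face → Set where
  root : ∀ {f} → LeafAt leaf f [] f
  in-first : ∀ {v a b c p q r α g} → LeafAt a (p , q , v) α g → LeafAt (node v a b c) (p , q , r) (first ∷ α) g
  in-second : ∀ {v a b c p q r α g} → LeafAt b (p , r , v) α g → LeafAt (node v a b c) (p , q , r) (second ∷ α) g
  in-third : ∀ {v a b c p q r α g} → LeafAt c (q , r , v) α g → LeafAt (node v a b c) (p , q , r) (third ∷ α) g

∈-leaves : ∀ t f {α g} → (α , g) ∈ leaves t f → LeafAt t f α g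
∈-leaves leaf f (here refl) = root
∈-leaves (node v a b c) (p , q , r) i with ∈-++⁻ (map (under first) (leaves a (p , q , v))) i
... | inj₁ j with ∈-map⁻ (under first) j
...   | _ , k , refl = in-first (∈-leaves a _ k)
∈-leaves (node v a b c) (p , q , r) i | inj₂ j with ∈-++⁻ (map (under second) (leaves b (p , r , v))) j
... | inj₁ k with ∈-map⁻ (under second) k
...   | _ , l , refl = in-second (∈-leaves b _ l)
∈-leaves (node v a b c) (p , q , r) i | inj₂ j | inj₂ k with ∈-map⁻ (under third) k
...   | _ , l , refl = in-third (∈-leaves c _ l)

-- An insertion only replaces the chosen leaf; up to order, all the others form one common `rest`.
leaves-growAt : ∀ {t f α g} v → LeafAt t f α g → ∃ λ rest →
  leaves t f ↭ (α , g) ∷ rest × leaves (growAt t α v) f ↭ split (α , g) v ++ rest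
leaves-growAt v root = [] , ↭-refl , ↭-refl
leaves-growAt {node w a b c} {p , q , r} v (in-first i) with leaves-growAt v i
... | rest , e , e′ = map (under first) rest ++ others , lift e , lift e′
  where
  others = map (under second) (leaves b (p , r , w)) ++ map (under third) (leaves c (q , r , w))
  lift : ∀ {xs ys} → xs ↭ ys → map (under first) xs ++ others ↭ map (under first) ys ++ others
  lift e = ++⁺ʳ others (map⁺ (under first) e)
leaves-growAt {node w a b c} {p , q , r} v (in-second {α = α} {g} i) with leaves-growAt v i
... | rest , e , e′ = xs ++ (map (under second) rest ++ zs) ,
    ↭-trans (lift e) (shifts xs ((second ∷ α , g) ∷ [])) , ↭-trans (lift e′) (shifts xs (split (second ∷ α , g) v))
  where
  xs = map (under first) (leaves a (p , q , w))
  zs = map (under third) (leaves c (q , r , w))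
  lift : ∀ {ys ys′} → ys ↭ ys′ → xs ++ (map (under second) ys ++ zs) ↭ xs ++ (map (under second) ys′ ++ zs)
  lift e = ++⁺ˡ xs (++⁺ʳ zs (map⁺ (under second) e))
leaves-growAt {node w a b c} {p , q , r} v (in-third {α = α} {g} i) with leaves-growAt v i
... | rest , e , e′ = xs ++ (ys ++ map (under third) rest) ,
    ↭-trans (lift e) (out ((third ∷ α , g) ∷ [])) , ↭-trans (lift e′) (out (split (third ∷ α , g) v))
  where
  xs = map (under first) (leaves a (p , q , w))
  ys = map (under second) (leaves b (p , r , w))
  lift : ∀ {zs zs′} → zs ↭ zs′ → xs ++ (ys ++ map (under third) zs) ↭ xs ++ (ys ++ map (under third) zs′)
  lift e = ++⁺ˡ xs (++⁺ˡ ys (map⁺ (under third) e))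
  out : ∀ ss {zs} → xs ++ (ys ++ (ss ++ zs)) ↭ ss ++ (xs ++ (ys ++ zs))
  out ss = ↭-trans (++⁺ˡ xs (shifts ys ss)) (shifts xs ss)

-- Forgetting labels, the choice of a face is one move of `grow`.
∑-leaves : ∀ t f v (F : Shape → ℕ) →
  (∑[ l ← leaves t f ] F (shape (growAt t (proj₁ l) v))) ≡ ∑ (grow (shape t)) F
∑-leaves leaf f v F = refl
∑-leaves (node w a b c) (p , q , r) v F = begin
  ∑ (xs ++ (ys ++ zs)) G
    ≡⟨ trans (∑-++ xs _ G) (cong (∑ xs G +_) (∑-++ ys zs G)) ⟩
  ∑ xs G + (∑ ys G + ∑ zs G)
    ≡⟨ cong₂ _+_ (trans (∑-map (under first) (leaves a _) G) (∑-leaves a _ v (λ a′ → F (node′ a′ (shape b) (shape c)))))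
      (cong₂ _+_ (trans (∑-map (under second) (leaves b _) G) (∑-leaves b _ v (λ b′ → F (node′ (shape a) b′ (shape c)))))
        (trans (∑-map (under third) (leaves c _) G) (∑-leaves c _ v (λ c′ → F (node′ (shape a) (shape b) c′))))) ⟩
  _ ≡⟨ ∑-grow-node (shape a) (shape b) (shape c) F ⟨
  ∑ (grow (shape (node w a b c))) F ∎
  where
  open ≡-Reasoning
  xs = map (under first) (leaves a (p , q , w))
  ys = map (under second) (leaves b (p , r , w))
  zs = map (under third) (leaves c (q , r , w))
  G : Address × Face → ℕ
  G l = F (shape (growAt (node w a b c) (proj₁ l) v))

cnt-growAt : ∀ {t f α g} v u → LeafAt t f α g →
  cnt u (verts (growAt t α v)) ≡ indicator (u ≟ v) + cnt u (verts t)
cnt-growAt v u root = refl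
cnt-growAt {node w a b c} v u (in-first {α = α} i)
  rewrite cnt-++ u (verts (growAt a α v)) (verts b ++ verts c) | cnt-++ u (verts a) (verts b ++ verts c)
        | cnt-growAt v u i = e (indicator (u ≟ w)) (indicator (u ≟ v)) (cnt u (verts a)) _
  where
  e : ∀ w v a b → w + (v + a + b) ≡ v + (w + (a + b))
  e = solve-∀
cnt-growAt {node w a b c} v u (in-second {α = α} i)
  rewrite cnt-++ u (verts a) (verts (growAt b α v) ++ verts c) | cnt-++ u (verts a) (verts b ++ verts c)
        | cnt-++ u (verts (growAt b α v)) (verts c) | cnt-++ u (verts b) (verts c)
        | cnt-growAt v u i = e (indicator (u ≟ w)) (indicator (u ≟ v)) (cnt u (verts a)) (cnt u (verts b)) _
  where
  e : ∀ w v a b c → w + (a + (v + b + c)) ≡ v + (w + (a + (b + c)))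
  e = solve-∀
cnt-growAt {node w a b c} v u (in-third {α = α} i)
  rewrite cnt-++ u (verts a) (verts b ++ verts (growAt c α v)) | cnt-++ u (verts a) (verts b ++ verts c)
        | cnt-++ u (verts b) (verts (growAt c α v)) | cnt-++ u (verts b) (verts c)
        | cnt-growAt v u i = e (indicator (u ≟ w)) (indicator (u ≟ v)) (cnt u (verts a)) (cnt u (verts b)) _
  where
  e : ∀ w v a b c → w + (a + (b + (v + c))) ≡ v + (w + (a + (b + c)))
  e = solve-∀

Edges-growAt : ∀ t f α v {u w} → Edges t f u w → Edges (growAt t α v) f u w
Edges-growAt (node _ a b c) f [] v e = e
Edges-growAt (node _ a b c) f (first ∷ α) v (inj₂ (inj₁ e)) = inj₂ (inj₁ (Edges-growAt a _ α v e))
Edges-growAt (node _ a b c) f (second ∷ α) v (inj₂ (inj₂ (inj₁ e))) = inj₂ (inj₂ (inj₁ (Edges-growAt b _ α v e)))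
Edges-growAt (node _ a b c) f (third ∷ α) v (inj₂ (inj₂ (inj₂ e))) = inj₂ (inj₂ (inj₂ (Edges-growAt c _ α v e)))
Edges-growAt (node _ a b c) f (first ∷ α) v (inj₁ e) = inj₁ e
Edges-growAt (node _ a b c) f (first ∷ α) v (inj₂ (inj₂ e)) = inj₂ (inj₂ e)
Edges-growAt (node _ a b c) f (second ∷ α) v (inj₁ e) = inj₁ e
Edges-growAt (node _ a b c) f (second ∷ α) v (inj₂ (inj₁ e)) = inj₂ (inj₁ e)
Edges-growAt (node _ a b c) f (second ∷ α) v (inj₂ (inj₂ (inj₂ e))) = inj₂ (inj₂ (inj₂ e))
Edges-growAt (node _ a b c) f (third ∷ α) v (inj₁ e) = inj₁ e
Edges-growAt (node _ a b c) f (third ∷ α) v (inj₂ (inj₁ e)) = inj₂ (inj₁ e)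
Edges-growAt (node _ a b c) f (third ∷ α) v (inj₂ (inj₂ (inj₁ e))) = inj₂ (inj₂ (inj₁ e))

Edges-new : ∀ {t f α g} v {u} → LeafAt t f α g → u ∈ corners g → Edges (growAt t α v) f u v
Edges-new v root i = inj₁ (inj₂ (refl , i))
Edges-new v (in-first l) i = inj₂ (inj₁ (Edges-new v l i))
Edges-new v (in-second l) i = inj₂ (inj₂ (inj₁ (Edges-new v l i)))
Edges-new v (in-third l) i = inj₂ (inj₂ (inj₂ (Edges-new v l i)))

outer : Face
outer = 0 , 1 , 2

-- The faces of build h, in the same order, with their addresses in tree h.
located : ∀ {k} → Hist k → Vec (Address × Face) (faces k)
located [] = ([] , outer) ∷ []
located {suc k} (h ▷ j) with lookup (located h) j
... | α , p , q , r = (α ∷ʳ first , p , q , 3 + k) ∷ (α ∷ʳ second , p , r , 3 + k) ∷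
    (α ∷ʳ third , q , r , 3 + k) ∷ removeAt (located h) j

tree : ∀ {k} → Hist k → Tree ℕ
tree [] = leaf
tree {suc k} (h ▷ j) = growAt (tree h) (proj₁ (lookup (located h) j)) (3 + k)

removeAt-↭ : ∀ {A : Set} {n} (xs : Vec A (suc n)) j → toList xs ↭ lookup xs j ∷ toList (removeAt xs j)
removeAt-↭ (x ∷ xs) zero = ↭-refl
removeAt-↭ (x ∷ xs@(_ ∷ _)) (suc j) = ↭-trans (prep x (removeAt-↭ xs j)) (Perm.swap x _ ↭-refl)

map-removeAt : ∀ {A B : Set} (f : A → B) {n} (xs : Vec A (suc n)) j →
  Vec.map f (removeAt xs j) ≡ removeAt (Vec.map f xs) j
map-removeAt f (x ∷ xs) zero = refl
map-removeAt f (x ∷ xs@(_ ∷ _)) (suc j) = cong (f x ∷_) (map-removeAt f xs j)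

located-faces : ∀ {k} (h : Hist k) → Vec.map proj₂ (located h) ≡ proj₁ (build h)
located-faces [] = refl
located-faces (h ▷ j)
  rewrite sym (located-faces h) | Vec.lookup-map j proj₂ (located h) | map-removeAt proj₂ (located h) j = refl

-- Mutual with `located-at`: an insertion requires the chosen address to be a leaf, which is read
-- off the permutation one step earlier.
located-leaves : ∀ {k} (h : Hist k) → toList (located h) ↭ leaves (tree h) outer
located-at : ∀ {k} (h : Hist k) j →
  LeafAt (tree h) outer (proj₁ (lookup (located h) j)) (proj₂ (lookup (located h) j))
located-at h j = ∈-leaves (tree h) outer
  (∈-resp-↭ (located-leaves h) (∈-resp-↭ (↭-sym (removeAt-↭ (located h) j)) (here refl)))
located-leaves [] = ↭-refl
located-leaves {suc k} (h ▷ j) with leaves-growAt (3 + k) (located-at h j)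
... | rest , e , e′ = ↭-trans (++⁺ˡ (split (lookup (located h) j) (3 + k))
    (drop-∷ (↭-trans (↭-sym (removeAt-↭ (located h) j)) (↭-trans (located-leaves h) e))))
  (↭-sym e′)

-- The first alternative is a side of the outer triangle; it cannot occur at an inner vertex, whose
-- label is at least 3.
tree-edges : ∀ {k} (h : Hist k) {u w} → (u , w) ∈ proj₂ (build h) →
  (u < 3 × w < 3) ⊎ Edges (tree h) outer u w
tree-edges [] (here refl) = inj₁ (s≤s z≤n , s≤s (s≤s z≤n))
tree-edges [] (there (here refl)) = inj₁ (s≤s (s≤s z≤n) , s≤s (s≤s (s≤s z≤n)))
tree-edges [] (there (there (here refl))) = inj₁ (s≤s z≤n , s≤s (s≤s (s≤s z≤n)))
tree-edges {suc k} (h ▷ j) {u} {w} i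
  rewrite sym (located-faces h) | Vec.lookup-map j proj₂ (located h) = go i
  where
  l = located-at h j
  go : (u , w) ∈ _ → (u < 3 × w < 3) ⊎ Edges (tree (h ▷ j)) outer u w
  go (here refl) = inj₂ (Edges-new (3 + k) l (here refl))
  go (there (here refl)) = inj₂ (Edges-new (3 + k) l (there (here refl)))
  go (there (there (here refl))) = inj₂ (Edges-new (3 + k) l (there (there (here refl))))
  go (there (there (there i))) = Sum.map₂ (Edges-growAt (tree h) outer _ (3 + k)) (tree-edges h i)

-- Distinctness is proved together with the freshness of the next label `3 + k`, which the induction
-- needs.
cnt-tree : ∀ {k} (h : Hist k) u →
  (u < 3 + k × cnt u (0 ∷ 1 ∷ 2 ∷ verts (tree h)) ≡ 1) ⊎ (3 + k ≤ u × cnt u (0 ∷ 1 ∷ 2 ∷ verts (tree h)) ≡ 0)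
cnt-tree [] 0 = inj₁ (s≤s z≤n , refl)
cnt-tree [] 1 = inj₁ (s≤s (s≤s z≤n) , refl)
cnt-tree [] 2 = inj₁ (s≤s (s≤s (s≤s z≤n)) , refl)
cnt-tree [] (suc (suc (suc u))) = inj₂ (s≤s (s≤s (s≤s z≤n)) , refl)
cnt-tree {suc k} (h ▷ j) u = step (cnt-tree h u)
  where
  grown : cnt u (0 ∷ 1 ∷ 2 ∷ verts (tree (h ▷ j))) ≡
    indicator (u ≟ 3 + k) + cnt u (0 ∷ 1 ∷ 2 ∷ verts (tree h))
  grown rewrite cnt-growAt (3 + k) u (located-at h j) =
    e (indicator (u ≟ 0)) (indicator (u ≟ 1)) (indicator (u ≟ 2)) (indicator (u ≟ 3 + k)) _
    where
    e : ∀ a b c v x → a + (b + (c + (v + x))) ≡ v + (a + (b + (c + x)))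
    e = solve-∀
  step : _ → _
  step (inj₁ (u<n , e)) = inj₁ (m≤n⇒m≤1+n u<n , trans grown (cong₂ _+_ other e))
    where
    other : indicator (u ≟ 3 + k) ≡ 0
    other with u ≟ 3 + k
    ... | yes refl = ⊥-elim (1+n≰n u<n)
    ... | no _ = refl
  step (inj₂ (n≤u , e)) with u ≟ 3 + k
  ... | yes refl = inj₁ (≤-refl , trans grown (cong₂ _+_ (cnt-self (3 + k)) e))
  ... | no u≢n = inj₂ (≤∧≢⇒< n≤u (u≢n ∘ sym) , trans grown (cong₂ _+_ other e))
    where
    other : indicator (u ≟ 3 + k) ≡ 0
    other with u ≟ 3 + k
    ... | yes e = ⊥-elim (u≢n e)
    ... | no _ = refl

Distinct-tree : ∀ {k} (h : Hist k) → Distinct (tree h) outer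
Distinct-tree h u with cnt-tree h u
... | inj₁ (_ , e) = ≤-reflexive e
... | inj₂ (_ , e) = ≤-trans (≤-reflexive e) z≤n

verts-≥3 : ∀ {k} (h : Hist k) {u} → u ∈ verts (tree h) → ¬ u < 3
verts-≥3 h {0} i _ = 1+n≰n (≤-trans (s≤s (∈⇒cnt i)) (Distinct-tree h 0))
verts-≥3 h {1} i _ = 1+n≰n (≤-trans (s≤s (∈⇒cnt i)) (Distinct-tree h 1))
verts-≥3 h {2} i _ = 1+n≰n (≤-trans (s≤s (∈⇒cnt i)) (Distinct-tree h 2))
verts-≥3 h {suc (suc (suc u))} i (s≤s (s≤s (s≤s ())))

Owns-tree : ∀ {k} (h : Hist k) → Owns (Adj h) (tree h) outer
Owns-tree h u w (inj₁ e) i with tree-edges h e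
... | inj₁ (u<3 , _) = ⊥-elim (verts-≥3 h i u<3)
... | inj₂ e′ = e′
Owns-tree h u w (inj₂ e) i with tree-edges h e
... | inj₁ (_ , u<3) = ⊥-elim (verts-≥3 h i u<3)
... | inj₂ e′ = Edges-sym (tree h) outer e′

Unique⇒simple : ∀ {p : List ℕ} → Unique p → ∀ v → (∑[ u ← p ] indicator (u ≟ v)) ≤ 1
Unique⇒simple [] v = z≤n
Unique⇒simple {u ∷ p} (u∉p ∷ d) v with u ≟ v
... | no _ = Unique⇒simple d v
... | yes refl = s≤s (≤-reflexive (absent u∉p))
  where
  absent : ∀ {q} → All (u ≢_) q → (∑[ x ← q ] indicator (x ≟ u)) ≡ 0
  absent [] = refl
  absent {x ∷ q} (u≢x ∷ r) with x ≟ u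
  ... | yes refl = ⊥-elim (u≢x refl)
  ... | no _ = absent r

length-∑ : ∀ {X : Set} (xs : List X) → length xs ≡ ∑ xs (λ _ → 1)
length-∑ [] = refl
length-∑ (x ∷ xs) = cong suc (length-∑ xs)

faces≡ : ∀ k → faces k ≡ 1 + 2 * k
faces≡ zero = refl
faces≡ (suc k) = trans (cong (2 +_) (faces≡ k)) (e k)
  where
  e : ∀ k → 2 + (1 + 2 * k) ≡ 1 + 2 * suc k
  e = solve-∀

size-growAt : ∀ {t f α g} v → LeafAt t f α g → size (growAt t α v) ≡ 2 + size t
size-growAt v root = refl
size-growAt {node _ a b c} v (in-first l) rewrite size-growAt v l = refl
size-growAt {node _ a b c} v (in-second l) rewrite size-growAt v l = e (size a) (size b) (size c)
  where
  e : ∀ a b c → a + (2 + b) + c ≡ 2 + (a + b + c)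
  e = solve-∀
size-growAt {node _ a b c} v (in-third l) rewrite size-growAt v l = e (size a) (size b) (size c)
  where
  e : ∀ a b c → a + b + (2 + c) ≡ 2 + (a + b + c)
  e = solve-∀

size-tree : ∀ {k} (h : Hist k) → size (tree h) ≡ faces k
size-tree [] = refl
size-tree {suc k} (h ▷ j) = trans (size-growAt (3 + k) (located-at h j)) (cong (2 +_) (size-tree h))

module _ (m d : ℕ) where
  open Potential m

  path-bound : ∀ {k} (h : Hist k) p → SimplePath h p → ∃ λ y →
    length p ≤ 3 + (y + slack d) × M ^ d * (y * y) ≤ faces k * Ψ d (shape (tree h))
  path-bound {k} h p (bounded , linked , unique) = reach d t , len , potential
    where
    open ≤-Reasoning
    open OnPath p linked (Unique⇒simple unique)
    t = tree h
    covered : ∀ {u} → u < 3 + k → 1 ≤ cnt u (0 ∷ 1 ∷ 2 ∷ verts t)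
    covered {u} u<n with cnt-tree h u
    ... | inj₁ (_ , e) = ≤-reflexive (sym e)
    ... | inj₂ (n≤u , _) = ⊥-elim (<⇒≱ u<n n≤u)
    len : length p ≤ 3 + (reach d t + slack d)
    len = begin
      length p                                  ≡⟨ length-∑ p ⟩
      ∑ p (λ _ → 1)                             ≤⟨ ∑-monoAll (All.map covered bounded) ⟩
      load (0 ∷ 1 ∷ 2 ∷ verts t)                ≤⟨ load-∷ 0 (1 ∷ 2 ∷ verts t) ⟩
      1 + load (1 ∷ 2 ∷ verts t)                ≤⟨ s≤s (load-∷ 1 (2 ∷ verts t)) ⟩
      2 + load (2 ∷ verts t)                    ≤⟨ s≤s (s≤s (load-∷ 2 (verts t))) ⟩
      3 + loadᵗ t                               ≤⟨ +-monoʳ-≤ 3 (loadᵗ-≤-reach d t) ⟩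
      3 + (reach d t + slack d)                 ∎
    potential : M ^ d * (reach d t * reach d t) ≤ faces k * Ψ d (shape t)
    potential = begin
      M ^ d * (reach d t * reach d t)           ≤⟨ reach-≤ m d t outer (good (Distinct-tree h) (Owns-tree h)) ⟩
      visit t * size t * Ψ d (shape t)          ≤⟨ *-monoˡ-≤ (Ψ d (shape t)) (*-monoˡ-≤ (size t) (sg-≤1 (loadᵗ t))) ⟩
      1 * size t * Ψ d (shape t)                ≡⟨ cong (_* Ψ d (shape t)) (trans (*-identityˡ _) (size-tree h)) ⟩
      faces k * Ψ d (shape t)                   ∎

-- The uniform measure on histories

histories : ∀ k → List (Hist k)
histories zero = [] ∷ []
histories (suc k) = concatMap (λ h → map (h ▷_) (allFin (faces k))) (histories k)

Unique-histories : ∀ k → Unique (histories k)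
Unique-histories zero = [] ∷ []
Unique-histories (suc k) = Unique.concat⁺
  (All.map⁺ (All.universal (λ h → Unique.map⁺ (λ { refl → refl }) (Unique.allFin⁺ (faces k))) (histories k)))
  (AllPairs.map⁺ (AllPairs.map apart (Unique-histories k)))
  where
  apart : ∀ {h h′ : Hist k} → h ≢ h′ → ∀ {x : Hist (suc k)} →
    ¬ (x ∈ map (h ▷_) (allFin (faces k)) × x ∈ map (h′ ▷_) (allFin (faces k)))
  apart {h} {h′} h≢h′ (i , i′) with ∈-map⁻ (h ▷_) i | ∈-map⁻ (h′ ▷_) i′
  ... | _ , _ , refl | _ , _ , refl = h≢h′ refl

∑-lookup : ∀ {X : Set} {n} (xs : Vec X n) (f : X → ℕ) → (∑[ j ← allFin n ] f (lookup xs j)) ≡ ∑ (toList xs) f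
∑-lookup {X} {n} xs f = trans (sym (∑-map (lookup xs) (allFin n) f))
  (trans (cong (λ l → ∑ l f) (map-tabulate id (lookup xs))) (go xs))
  where
  go : ∀ {n} (xs : Vec X n) → ∑ (tabulate (lookup xs)) f ≡ ∑ (toList xs) f
  go [] = refl
  go (x ∷ xs) = cong (f x +_) (go xs)

-- Carries all estimates on `walks` over to the model: the faces of `build` are the leaves of the
-- tree up to order, which a sum does not see.
∑-histories : ∀ k (F : Shape → ℕ) → (∑[ h ← histories k ] F (shape (tree h))) ≡ walks grow k F leaf
∑-histories zero F = +-identityʳ _
∑-histories (suc k) F = begin
  (∑[ h ← histories (suc k) ] F (shape (tree h)))
    ≡⟨ ∑-concatMap (λ h → map (h ▷_) (allFin (faces k))) (histories k) _ ⟩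
  (∑[ h ← histories k ] ∑[ x ← map (h ▷_) (allFin (faces k)) ] F (shape (tree x)))
    ≡⟨ ∑-cong (histories k) step ⟩
  (∑[ h ← histories k ] ∑ (grow (shape (tree h))) F)
    ≡⟨ ∑-histories k (λ t → ∑ (grow t) F) ⟩
  walks grow k (λ t → ∑ (grow t) F) leaf
    ≡⟨ walks-suc grow k F leaf ⟨
  walks grow (suc k) F leaf ∎
  where
  open ≡-Reasoning
  step : ∀ h → (∑[ x ← map (h ▷_) (allFin (faces k)) ] F (shape (tree x))) ≡ ∑ (grow (shape (tree h))) F
  step h = trans (∑-map (h ▷_) (allFin (faces k)) _)
    (trans (∑-lookup (located h) (λ l → F (shape (growAt (tree h) (proj₁ l) (3 + k)))))
      (trans (∑-↭ _ (located-leaves h)) (∑-leaves (tree h) outer (3 + k) F)))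

length-histories : ∀ k → length (histories k) ≡ rise 1 k
length-histories k = trans (length-∑ (histories k)) (trans (∑-histories k (λ _ → 1)) (total-walks k))

total≡ : ∀ k → total k ≡ rise 1 k
total≡ zero = refl
total≡ (suc k) = begin
  total k * faces k                 ≡⟨ cong₂ _*_ (total≡ k) (faces≡ k) ⟩
  rise 1 k * (1 + 2 * k)            ≡⟨ cong (rise 1 k *_) (*-identityʳ (1 + 2 * k)) ⟨
  rise 1 k * rise (1 + 2 * k) 1     ≡⟨ rise-+ 1 k 1 ⟨
  rise 1 (k + 1)                    ≡⟨ cong (rise 1) (+-comm k 1) ⟩
  rise 1 (suc k)                    ∎
  where open ≡-Reasoning

-- Conclusion

^-distribʳ-* : ∀ d m n → (m * n) ^ d ≡ m ^ d * n ^ d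
^-distribʳ-* zero m n = refl
^-distribʳ-* (suc d) m n = trans (cong (m * n *_) (^-distribʳ-* d m n)) (e m n (m ^ d) (n ^ d))
  where
  e : ∀ m n x y → m * n * (x * y) ≡ m * x * (n * y)
  e = solve-∀

bernoulli : ∀ b d → b ^ d * (b + d) ≤ b * suc b ^ d
bernoulli b zero = ≤-reflexive (e b)
  where
  e : ∀ b → 1 * (b + 0) ≡ b * 1
  e = solve-∀
bernoulli b (suc d) = begin
  b * b ^ d * (b + suc d)                       ≤⟨ m≤m+n _ (b ^ d * d) ⟩
  b * b ^ d * (b + suc d) + b ^ d * d           ≡⟨ e b (b ^ d) d ⟩
  suc b * (b ^ d * (b + d))                     ≤⟨ *-monoʳ-≤ (suc b) (bernoulli b d) ⟩
  suc b * (b * suc b ^ d)                       ≡⟨ e′ b (suc b ^ d) ⟩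
  b * (suc b * suc b ^ d)                       ∎
  where
  open ≤-Reasoning
  e : ∀ b x d → b * x * (b + (1 + d)) + x * d ≡ (1 + b) * (x * (b + d))
  e = solve-∀
  e′ : ∀ b x → (1 + b) * (b * x) ≡ b * ((1 + b) * x)
  e′ = solve-∀

geometric-gap : ∀ t b → ∃ λ d → t * b ^ d ≤ suc b ^ d
geometric-gap t zero = 1 , ≤-trans (≤-reflexive (*-zeroʳ t)) z≤n
-- For d = t b Bernoulli's inequality gives (1 + 1 / b) ^ d ≥ 1 + t.
geometric-gap t b@(suc _) = t * b , *-cancelˡ-≤ b (begin
  b * (t * b ^ d)            ≤⟨ m≤n+m _ (b * b ^ d) ⟩
  b * b ^ d + b * (t * b ^ d) ≡⟨ e b (b ^ d) t ⟩
  b ^ d * (b + t * b)        ≤⟨ bernoulli b d ⟩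
  b * suc b ^ d              ∎)
  where
  open ≤-Reasoning
  d = t * b
  e : ∀ b x t → b * x + b * (t * x) ≡ x * (b + t * b)
  e = solve-∀

markov : ∀ {X : Set} (f : X → ℕ) V xs →
  V * length xs ≤ V * length (filter (λ x → f x ≤? V) xs) + ∑ xs f
markov f V [] = m≤m+n _ 0
markov {X} f V (x ∷ xs) = go (f x ≤? V)
  where
  open ≤-Reasoning
  below : ∀ x → Dec (f x ≤ V)
  below x = f x ≤? V
  l = length (filter below xs)
  exchange : ∀ a b c → a + (b + c) ≡ b + (a + c)
  exchange = solve-∀
  go : Dec (f x ≤ V) → V * length (x ∷ xs) ≤ V * length (filter below (x ∷ xs)) + ∑ (x ∷ xs) f
  go (yes q) rewrite filter-accept below {xs = xs} q = begin
    V * suc (length xs)               ≡⟨ *-suc V _ ⟩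
    V + V * length xs                 ≤⟨ +-monoʳ-≤ V (markov f V xs) ⟩
    V + (V * l + ∑ xs f)              ≤⟨ +-monoʳ-≤ V (+-monoʳ-≤ (V * l) (m≤n+m _ (f x))) ⟩
    V + (V * l + (f x + ∑ xs f))      ≡⟨ +-assoc V _ _ ⟨
    V + V * l + (f x + ∑ xs f)        ≡⟨ cong (_+ (f x + ∑ xs f)) (*-suc V l) ⟨
    V * suc l + (f x + ∑ xs f)        ∎
  go (no ¬q) rewrite filter-reject below {xs = xs} ¬q = begin
    V * suc (length xs)               ≡⟨ *-suc V _ ⟩
    V + V * length xs                 ≤⟨ +-mono-≤ (<⇒≤ (≰⇒> ¬q)) (markov f V xs) ⟩
    f x + (V * l + ∑ xs f)            ≡⟨ exchange (f x) (V * l) (∑ xs f) ⟩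
    V * l + (f x + ∑ xs f)            ∎

module _ (c e : ℕ) .{{_ : NonZero c}} where

  private
    s m : ℕ
    -- The factor 2 keeps half of the allowed length N / c for the additive terms of `path-bound`; m
    -- makes `M` large enough for `balanced-often`.
    s = 2 * c
    m = 2 * (R₀ * c₀)
  open Potential m

  private
    often : ∀ k → M ≤ 1 + 2 * k → rise 1 k ≤ M * walks grow k bal leaf
    often k = balanced-often M (n≤1+n m) k (1 + 2 * k) refl

    -- The decay must beat e from the failure probability, s² from the squared path length, and 2 to
    -- leave room for `offset`.
    gap : ∃ λ d → 2 * (e * (s * s)) * B ^ d ≤ suc B ^ d
    gap = geometric-gap (2 * (e * (s * s))) B
    d : ℕ
    d = proj₁ gap

  -- The first summand absorbs the additive terms in the path length, the second those in the
  -- average of `Ψ`.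
  threshold : ℕ
  threshold = s * (3 + slack d) + 2 * (e * (s * s)) * offset d

  module _ (k : ℕ) (k-large : threshold ≤ k) where

    private
      N V : ℕ
      N = faces k
      V = M ^ d * N
      -- Scaled so that a score of at most `V` turns `path-bound` into (s y)² ≤ N².
      score : Hist k → ℕ
      score h = s * s * Ψ d (shape (tree h))

      threshold≤N : threshold ≤ N
      threshold≤N = ≤-trans k-large (≤-trans (m≤n+m k (suc k))
        (≤-reflexive (trans (double k) (sym (faces≡ k)))))
        where
        double : ∀ k → suc k + k ≡ 1 + 2 * k
        double = solve-∀

    tame : List (Hist k)
    tame = filter (λ h → score h ≤? V) (histories k)

    tame-paths : ∀ h → score h ≤ V → ∀ p → SimplePath h p → length p * c ≤ N
    tame-paths h tm p sp with path-bound m d h p sp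
    ... | y , len , pot = *-cancelˡ-≤ 2 (begin
      2 * (length p * c)                     ≡⟨ r₁ (length p) c ⟩
      s * length p                           ≤⟨ *-monoʳ-≤ s len ⟩
      s * (3 + (y + slack d))                ≡⟨ r₂ s y (slack d) ⟩
      s * y + s * (3 + slack d)              ≤⟨ +-mono-≤ sy≤N (≤-trans (m≤m+n _ _) threshold≤N) ⟩
      N + N                                  ≡⟨ cong (N +_) (+-identityʳ N) ⟨
      2 * N                                  ∎)
      where
      open ≤-Reasoning
      r₁ : ∀ l c → 2 * (l * c) ≡ 2 * c * l
      r₁ = solve-∀
      r₂ : ∀ s y z → s * (3 + (y + z)) ≡ s * y + s * (3 + z)
      r₂ = solve-∀
      r₃ : ∀ a s y → a * (s * y * (s * y)) ≡ s * s * (a * (y * y))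
      r₃ = solve-∀
      r₄ : ∀ t n x → t * (n * x) ≡ n * (t * x)
      r₄ = solve-∀
      sy≤N : s * y ≤ N
      sy≤N = square-cancel-≤ (*-cancelˡ-≤ (M ^ d) {{m^n≢0 M d}} (begin
        M ^ d * (s * y * (s * y))            ≡⟨ r₃ (M ^ d) s y ⟩
        s * s * (M ^ d * (y * y))            ≤⟨ *-monoʳ-≤ (s * s) pot ⟩
        s * s * (N * Ψ d (shape (tree h)))   ≡⟨ r₄ (s * s) N _ ⟩
        N * score h                          ≤⟨ *-monoʳ-≤ N tm ⟩
        N * (M ^ d * N)                      ≡⟨ r₄ N (M ^ d) N ⟩
        M ^ d * (N * N)                      ∎))

    -- Markov's inequality: by `small` the average score is at most V / e, so at most a fraction 1 /
    -- e of the histories is not tame. `U` is the common factor cancelled.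
    tame-many : total k * e ≤ length tame * e + total k
    tame-many = *-cancelˡ-≤ U {{m*n≢0 (M ^ d) V {{m^n≢0 M d}} {{m*n≢0 (M ^ d) N {{m^n≢0 M d}}}}}} (begin
      U * (total k * e)                                    ≡⟨ r₁ (M ^ d) V (total k) e ⟩
      e * (M ^ d * (V * total k))                          ≡⟨ cong (λ z → e * (M ^ d * (V * z))) total≡length ⟩
      e * (M ^ d * (V * length (histories k)))             ≤⟨ *-monoʳ-≤ e (*-monoʳ-≤ (M ^ d) (markov score V (histories k))) ⟩
      e * (M ^ d * (V * g + ∑ (histories k) score))        ≡⟨ cong (λ z → e * (M ^ d * (V * g + z))) score-sum ⟩
      e * (M ^ d * (V * g + s * s * W))                    ≡⟨ r₂ e (M ^ d) V g (s * s) W ⟩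
      U * (g * e) + e * (s * s) * (M ^ d * W)              ≤⟨ +-monoʳ-≤ (U * (g * e)) (*-monoʳ-≤ (e * (s * s)) W-bound) ⟩
      U * (g * e) + e * (s * s) * ((B ^ d * N + offset d) * total k)
        ≤⟨ +-monoʳ-≤ (U * (g * e)) (≤-trans (≤-reflexive (sym (*-assoc (e * (s * s)) _ _))) (*-monoˡ-≤ (total k) small)) ⟩
      U * (g * e) + U * total k                            ≡⟨ *-distribˡ-+ U (g * e) (total k) ⟨
      U * (g * e + total k)                                ∎)
      where
      open ≤-Reasoning
      U = M ^ d * V
      g = length tame
      W = walks grow k (Ψ d) leaf
      r₁ : ∀ a v t e → a * v * (t * e) ≡ e * (a * (v * t))
      r₁ = solve-∀
      r₂ : ∀ e a v g s w → e * (a * (v * g + s * w)) ≡ a * v * (g * e) + e * s * (a * w)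
      r₂ = solve-∀
      total≡length : total k ≡ length (histories k)
      total≡length = trans (total≡ k) (sym (length-histories k))
      score-sum : ∑ (histories k) score ≡ s * s * W
      score-sum = trans (∑-* (histories k) (s * s) (λ h → Ψ d (shape (tree h))))
        (cong (s * s *_) (∑-histories k (Ψ d)))
      W-bound : M ^ d * W ≤ (B ^ d * N + offset d) * total k
      W-bound = subst₂ (λ n z → M ^ d * W ≤ (B ^ d * n + offset d) * z)
        (sym (faces≡ k)) (sym (total≡ k)) (walks-Ψ often d k)
      small : e * (s * s) * (B ^ d * N + offset d) ≤ U
      small = *-cancelˡ-≤ 2 (begin
        2 * (e * (s * s) * (B ^ d * N + offset d))
          ≡⟨ r₃ (e * (s * s)) (B ^ d) N (offset d) ⟩
        2 * (e * (s * s)) * B ^ d * N + 2 * (e * (s * s)) * offset d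
          ≤⟨ +-mono-≤ (*-monoˡ-≤ N (proj₂ gap)) (≤-trans (m≤n+m _ _) threshold≤N) ⟩
        suc B ^ d * N + N
          ≤⟨ +-monoʳ-≤ (suc B ^ d * N) (≤-trans (≤-reflexive (sym (*-identityˡ N))) (*-monoˡ-≤ N (m^n>0 (suc B) d))) ⟩
        suc B ^ d * N + suc B ^ d * N
          ≡⟨ cong (suc B ^ d * N +_) (+-identityʳ _) ⟨
        2 * (suc B ^ d * N)
          ≡⟨ cong (λ z → 2 * (z * N)) squares ⟩
        2 * (M ^ d * M ^ d * N)
          ≡⟨ cong (2 *_) (*-assoc (M ^ d) (M ^ d) N) ⟩
        2 * U ∎)
        where
        r₃ : ∀ t b n o → 2 * (t * (b * n + o)) ≡ 2 * t * b * n + 2 * t * o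
        r₃ = solve-∀
        squares : suc B ^ d ≡ M ^ d * M ^ d
        squares = ^-distribʳ-* d M M

-- Passage to rational bounds

-- The integer inequality is the rational one multiplied by the denominator of ε.
ℕ→ℚ-≤ : ∀ ε → Positive ε → ∀ a b n → a * ↧ₙ ε ≤ b * ↧ₙ ε + n → ℕ→ℚ a ℚ.≤ ℕ→ℚ b ℚ.+ ε ℚ.* ℕ→ℚ n
ℕ→ℚ-≤ ε@(mkℚ (ℤ.+ suc i) d-1 _) _ a b n h = ℚ.toℚᵘ-cancel-≤ (begin
  toℚᵘ (ℕ→ℚ a)                                     ≃⟨ ℚ.toℚᵘ-fromℚᵘ (u a) ⟩
  u a                                              ≤⟨ unnormalised ⟩
  u b ℚᵘ.+ toℚᵘ ε ℚᵘ.* u n                         ≃⟨ ℚᵘ.+-cong (ℚ.toℚᵘ-fromℚᵘ (u b)) (ℚᵘ.*-congˡ {toℚᵘ ε} (ℚ.toℚᵘ-fromℚᵘ (u n))) ⟨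
  toℚᵘ (ℕ→ℚ b) ℚᵘ.+ toℚᵘ ε ℚᵘ.* toℚᵘ (ℕ→ℚ n)       ≃⟨ ℚᵘ.+-congʳ (toℚᵘ (ℕ→ℚ b)) (ℚ.toℚᵘ-homo-* ε (ℕ→ℚ n)) ⟨
  toℚᵘ (ℕ→ℚ b) ℚᵘ.+ toℚᵘ (ε ℚ.* ℕ→ℚ n)             ≃⟨ ℚ.toℚᵘ-homo-+ (ℕ→ℚ b) (ε ℚ.* ℕ→ℚ n) ⟨
  toℚᵘ (ℕ→ℚ b ℚ.+ ε ℚ.* ℕ→ℚ n)                     ∎)
  where
  open ℚᵘ.≤-Reasoning
  c = suc d-1
  u : ℕ → ℚᵘ.ℚᵘ
  u n = ℚᵘ.mkℚᵘ (ℤ.+ n) 0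
  nat : a * (1 * (c * 1)) ≤ (b * (c * 1) + suc i * n * 1) * 1
  nat = ≤-trans (≤-reflexive (e₁ a c)) (≤-trans h (≤-trans (+-monoʳ-≤ (b * c) (m≤m+n n (i * n))) (≤-reflexive (e₂ b c (suc i * n)))))
    where
    e₁ : ∀ a c → a * (1 * (c * 1)) ≡ a * c
    e₁ = solve-∀
    e₂ : ∀ b c x → b * c + x ≡ (b * (c * 1) + x * 1) * 1
    e₂ = solve-∀
  unnormalised : u a ℚᵘ.≤ u b ℚᵘ.+ toℚᵘ ε ℚᵘ.* u n
  unnormalised = ℚᵘ.*≤* (subst₂ ℤ._≤_ (ℤ.pos-* a (1 * (c * 1))) right (ℤ.+≤+ nat))
    where
    right : ℤ.+ ((b * (c * 1) + suc i * n * 1) * 1) ≡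
      (ℤ.+ b ℤ.* ℤ.+ (c * 1) ℤ.+ ℤ.+ suc i ℤ.* ℤ.+ n ℤ.* ℤ.+ 1) ℤ.* ℤ.+ 1
    right = trans (ℤ.pos-* (b * (c * 1) + suc i * n * 1) 1) (cong (ℤ._* ℤ.+ 1)
      (trans (ℤ.pos-+ (b * (c * 1)) _) (cong₂ ℤ._+_ (ℤ.pos-* b (c * 1))
        (trans (ℤ.pos-* (suc i * n) 1) (cong (ℤ._* ℤ.+ 1) (ℤ.pos-* (suc i) n))))))

complement-≤ : ∀ δ x y → x ℚ.≤ y ℚ.+ δ ℚ.* x → (1ℚ ℚ.- δ) ℚ.* x ℚ.≤ y
complement-≤ δ x y h = begin
  (1ℚ ℚ.- δ) ℚ.* x                                 ≡⟨ ℚ.*-distribʳ-+ x 1ℚ (ℚ.- δ) ⟩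
  1ℚ ℚ.* x ℚ.+ (ℚ.- δ) ℚ.* x                       ≡⟨ cong₂ ℚ._+_ (ℚ.*-identityˡ x) (sym (ℚ.neg-distribˡ-* δ x)) ⟩
  x ℚ.+ (ℚ.- (δ ℚ.* x))                            ≤⟨ ℚ.+-monoˡ-≤ (ℚ.- (δ ℚ.* x)) h ⟩
  y ℚ.+ δ ℚ.* x ℚ.+ (ℚ.- (δ ℚ.* x))                ≡⟨ ℚ.+-assoc y _ _ ⟩
  y ℚ.+ (δ ℚ.* x ℚ.+ (ℚ.- (δ ℚ.* x)))              ≡⟨ cong (y ℚ.+_) (ℚ.+-inverseʳ (δ ℚ.* x)) ⟩
  y ℚ.+ ℚ.0ℚ                                       ≡⟨ ℚ.+-identityʳ y ⟩
  y                                                ∎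
  where open ℚ.≤-Reasoning

theorem1 : (ε : ℚ) → Positive ε → (δ : ℚ) → Positive δ →
    Σ ℕ (λ K → (k : ℕ) → k ≥ K →
    ProbAtLeast k (LongestPathAtMost ε) (1ℚ - δ))
theorem1 ε ε>0 δ δ>0 = threshold c e , λ k k≥K →
  tame c e k k≥K ,
  Unique.filter⁺ _ (Unique-histories k) ,
  All.map (λ {h} tm p sp → subst (ℕ→ℚ (length p) ℚ.≤_) (ℚ.+-identityˡ _)
      (ℕ→ℚ-≤ ε ε>0 (length p) 0 (faces k) (tame-paths c e k k≥K h tm p sp)))
    (All.all-filter _ (histories k)) ,
  complement-≤ δ _ _ (ℕ→ℚ-≤ δ δ>0 (total k) (length (tame c e k k≥K)) (total k) (tame-many c e k k≥K))
  where
  -- A positive rational is at least the reciprocal of its denominator, so 1 / c and 1 / e may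
  -- replace ε and δ.
  c = suc (ℚ.ℚ.denominator-1 ε)
  e = ↧ₙ δ
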